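{- Let $m\ge 2$ be an integer. Any $c$-consistent strategy for searching in the $m$-ray star with directional prediction, where $c=1+2\tilde c$ with $\tilde c>1$, has robustness at least $$1+2\rho^*_{m-1}\Bigl(1+\frac{1}{\tilde c-1}\Bigr).$$ In particular, for $m\to\infty$, its robustness is at least $1+2e(m-1)\bigl(1+\frac{1}{\tilde c-1}\bigr)$, in the asymptotic sense that $e(m-1)$ here stands for $\rho^*_{m-1}=(1+o(1))\,e(m-1)$, with $o(1)$ depending only on $m$.
   Context: The $m$-ray star consists of $m$ unbounded rays, indexed $0,\ldots,m-1$, with a common endpoint $O$ (the origin). A search strategy is an infinite sequence $X=(x_i,u_i)_{i}$ with $x_i\in\mathbb{R}^+$ and $u_i\in\{0,\ldots,m-1\}$: in iteration $i$ a unit-speed searcher starts from $O$, walks on ray $u_i$ up to distance $x_i$ from $O$, returns to $O$, and continues with iteration $i+1$, until the target is located. For a target $t$, $d(t)$ is its distance from $O$, and $d(X,t)$ is the total distance walked until the searcher first reaches $t$ ($\infty$ if never). Standing assumption: targets are at distance at least some fixed constant $d_0>0$ from $O$. In the directional prediction model the prediction is an index $h\in\{0,\ldots,m-1\}$, the predicted ray on which the target hides. A strategy with directional prediction specifies a search strategy $X_h$ for every $h$. Its consistency is its competitive ratio with error-free prediction, i.e. $\sup d(X_h,t)/d(t)$ over all $h$ and all targets $t$ on ray $h$; its robustness is its competitive ratio under adversarial prediction, i.e. $\sup d(X_h,t)/d(t)$ over all $h$ and all targets $t$. It is $c$-consistent if its consistency is at most $c$. For an integer $n\ge 1$, $\rho^*_n=\frac{n^n}{(n-1)^{n-1}}$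 (with $0^0=1$, so $\rho^*_1=1$); the optimal competitive ratio for $n$-ray search without prediction is $1+2\rho^*_n$. -}

module Defs where

open import Algebra.Bundles using (CommutativeRing)
open import Algebra.Core using (Op₁; Op₂)
import Algebra.Properties.Ring as RingProperties
import Algebra.Properties.Semiring.Mult as Mult
import Algebra.Properties.Semiring.Sum as Sum
open import Algebra.Structures using (IsCommutativeRing)
open import Data.Fin.Base using (Fin; toℕ)
open import Data.Maybe.Base using (map)
open import Data.Nat.Base as ℕ using (ℕ; zero; suc; _!; _∸_)
open import Data.Product.Base using (Σ; ∃; _×_; _,_; proj₁)
open import Data.Sum.Base using (_⊎_; inj₁; inj₂)
open import Level using (0ℓ)
open import Relation.Binary.Bundles using (DecTotalOrder; StrictTotalOrder)
open import Relation.Binary.Core using (Rel)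
import Relation.Binary.Construct.Add.Supremum.NonStrict as AddSupremum
import Relation.Binary.Construct.StrictToNonStrict as ToNonStrict
open import Relation.Binary.Definitions using (tri<; tri≈; tri>)
open import Relation.Binary.PropositionalEquality.Core as ≡ using (_≡_)
open import Relation.Binary.Properties.StrictTotalOrder using (decTotalOrder)
open import Relation.Binary.Structures using (IsStrictTotalOrder)
open import Relation.Nullary.Construct.Add.Supremum using (_⁺; [_]; ⊤⁺)
open import Relation.Nullary.Decidable.Core using (Dec; yes; no)
open import Relation.Nullary.Negation.Core using (¬_; contradiction)
open import Relation.Unary using (Pred; _∈_)

-- The real numbers, given by their classical axioms: ℝ is the
-- Dedekind-complete ordered field, unique up to isomorphism.  Equality is a
-- setoid equality, so that ℝ may be a type of representatives.

record CompleteOrderedField : Set₁ where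
  infix  8 -_
  infix  9 _⁻¹
  infixl 7 _*_ _/_
  infixl 6 _+_
  infix  4 _≈_ _<_
  field
    Carrier            : Set
    _≈_                : Rel Carrier 0ℓ
    _<_                : Rel Carrier 0ℓ
    _+_                : Op₂ Carrier
    _*_                : Op₂ Carrier
    -_                 : Op₁ Carrier
    _⁻¹                : Op₁ Carrier
    0#                 : Carrier
    1#                 : Carrier
    isCommutativeRing  : IsCommutativeRing _≈_ _+_ _*_ -_ 0# 1#
    isStrictTotalOrder : IsStrictTotalOrder _≈_ _<_
    0<1                : 0# < 1#
    +-monoˡ-<          : ∀ x y z → x < y → x + z < y + z
    *-pos              : ∀ x y → 0# < x → 0# < y → 0# < x * y
    -- The value of 0# ⁻¹ is left unspecified.
    *-inverseʳ         : ∀ x → ¬ (x ≈ 0#) → x * x ⁻¹ ≈ 1#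

  open ToNonStrict _≈_ _<_ public using (_≤_)

  IsUpperBound : Pred Carrier 0ℓ → Carrier → Set
  IsUpperBound S b = ∀ x → x ∈ S → x ≤ b

  IsSupremum : Pred Carrier 0ℓ → Carrier → Set
  IsSupremum S s = IsUpperBound S s × (∀ y → y < s → ∃ λ x → x ∈ S × y < x)

  field
    supremum : ∀ S → ∃ (λ x → x ∈ S) → ∃ (IsUpperBound S) → ∃ (IsSupremum S)

  commutativeRing : CommutativeRing 0ℓ 0ℓ
  commutativeRing = record { isCommutativeRing = isCommutativeRing }

  strictTotalOrder : StrictTotalOrder 0ℓ 0ℓ 0ℓ
  strictTotalOrder = record { isStrictTotalOrder = isStrictTotalOrder }

  open CommutativeRing commutativeRing public using (_-_)

  _/_ : Op₂ Carrier
  x / y = x * y ⁻¹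

module Search (ℝ : CompleteOrderedField) where

  open CompleteOrderedField ℝ public

  private
    module R  = CommutativeRing commutativeRing
    module RP = RingProperties R.ring
    module O  = IsStrictTotalOrder isStrictTotalOrder
    module M  = Mult R.semiring
    module ≤  = DecTotalOrder (decTotalOrder strictTotalOrder)

    <-≤-trans : ∀ {x y z} → x < y → y ≤ z → x < z
    <-≤-trans = ToNonStrict.<-≤-trans _≈_ _<_ O.trans O.<-respʳ-≈

  open Sum R.semiring public using (sum)

  fromℕ : ℕ → Carrier
  fromℕ n = n M.× 1#

  -- Suprema together with decidability of the order give excluded middle.

  excludedMiddle : (P : Set) → Dec P
  excludedMiddle P = decide (supremum S (0# , inj₁ R.refl) (1# , bound))
    where
    S : Pred Carrier 0ℓ
    S x = x ≈ 0# ⊎ (x ≈ 1# × P)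

    bound : IsUpperBound S 1#
    bound x (inj₁ x≈0)       = inj₁ (O.<-respˡ-≈ (R.sym x≈0) 0<1)
    bound x (inj₂ (x≈1 , _)) = inj₂ x≈1

    decide : ∃ (IsSupremum S) → Dec P
    decide (s , ub , approx) with O.compare 0# s
    ... | tri< 0<s _ _ with approx 0# 0<s
    ...   | x , inj₁ x≈0     , 0<x = contradiction 0<x (O.irrefl (R.sym x≈0))
    ...   | x , inj₂ (_ , p) , _   = yes p
    decide (s , ub , approx) | tri≈ 0≮s _ _ =
      no λ p → 0≮s (<-≤-trans 0<1 (ub 1# (inj₂ (R.refl , p))))
    decide (s , ub , approx) | tri> 0≮s _ _ =
      no λ p → 0≮s (<-≤-trans 0<1 (ub 1# (inj₂ (R.refl , p))))

  -- ℝ ∪ {∞}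

  ℝ∞ : Set
  ℝ∞ = Carrier ⁺

  open AddSupremum _≤_ public renaming (_≤⁺_ to infix 4 _≤∞_) using ()

  -- The least upper bound in [0 , ∞] of a family of elements of [0 , ∞].

  ⋁ : {I : Set} → (I → ℝ∞) → ℝ∞
  ⋁ {I} f with excludedMiddle (∃ λ b → 0# ≤ b × (∀ i → f i ≤∞ [ b ]))
  ... | no  _               = ⊤⁺
  ... | yes (b , 0≤b , f≤b) =
    [ proj₁ (supremum S (0# , inj₁ R.refl) (b , bound)) ]
    where
    S : Pred Carrier 0ℓ
    S x = x ≈ 0# ⊎ ∃ λ i → f i ≡ [ x ]

    bound : IsUpperBound S b
    bound x (inj₁ x≈0)       = ≤.≤-respˡ-≈ (R.sym x≈0) 0≤b
    bound x (inj₂ (i , fi≡x)) = AddSupremum.[≤]-injective _≤_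
      (≡.subst (λ v → v ≤∞ [ b ]) fi≡x (f≤b i))

  -- Iteration i walks on ray (ray i) up to distance (length i) and back.

  record SearchStrategy (m : ℕ) : Set where
    field
      length     : ℕ → Carrier
      length-pos : ∀ i → 0# < length i
      ray        : ℕ → Fin m

  record Target (m : ℕ) (d₀ : Carrier) : Set where
    field
      ray         : Fin m
      distance    : Carrier
      d₀≤distance : d₀ ≤ distance

  module _ {m : ℕ} {d₀ : Carrier} where

    Reaches : SearchStrategy m → Target m d₀ → ℕ → Set
    Reaches X t i = X.ray i ≡ t.ray × t.distance ≤ X.length i
      where
      module X = SearchStrategy X
      module t = Target t

    FirstReaches : SearchStrategy m → Target m d₀ → ℕ → Set
    FirstReaches X t i = Reaches X t i × (∀ j → j ℕ.< i → ¬ Reaches X t j)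

    -- d(X , t): every iteration before the successful one is walked out and
    -- back, the successful one only as far as the target.

    searchCost : SearchStrategy m → Target m d₀ → ℝ∞
    searchCost X t with excludedMiddle (∃ (FirstReaches X t))
    ... | no  _       = ⊤⁺
    ... | yes (i , _) =
      [ fromℕ 2 * sum (λ (j : Fin i) → SearchStrategy.length X (toℕ j))
        + Target.distance t ]

    ratio : SearchStrategy m → Target m d₀ → ℝ∞
    ratio X t = map (_/ Target.distance t) (searchCost X t)

  DirectionalStrategy : ℕ → Set
  DirectionalStrategy m = Fin m → SearchStrategy m

  module _ {m : ℕ} (d₀ : Carrier) (X : DirectionalStrategy m) where

    consistency : ℝ∞
    consistency = ⋁ {I = Σ (Fin m) λ h → Σ (Target m d₀) λ t → Target.ray t ≡ h}
                    λ (h , t , _) → ratio (X h) t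

    robustness : ℝ∞
    robustness = ⋁ {I = Fin m × Target m d₀} λ (h , t) → ratio (X h) t

    IsConsistent : Carrier → Set
    IsConsistent c = consistency ≤∞ [ c ]

  ρ* : ℕ → Carrier
  ρ* n = fromℕ (n ℕ.^ n) / fromℕ ((n ∸ 1) ℕ.^ (n ∸ 1))

  TendsToZero : (ℕ → Carrier) → Set
  TendsToZero δ =
    ∀ ε → 0# < ε → ∃ λ N → ∀ n → N ℕ.≤ n → - ε < δ n × δ n < ε

  private
    +-monoʳ-< : ∀ x y z → x < y → z + x < z + y
    +-monoʳ-< x y z x<y =
      O.<-respʳ-≈ (R.+-comm y z) (O.<-respˡ-≈ (R.+-comm x z) (+-monoˡ-< x y z x<y))

    +-monoʳ-≤ : ∀ z {x y} → x ≤ y → z + x ≤ z + y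
    +-monoʳ-≤ z {x} {y} (inj₁ x<y) = inj₁ (+-monoʳ-< x y z x<y)
    +-monoʳ-≤ z         (inj₂ x≈y) = inj₂ (R.+-congˡ x≈y)

    ≤-+-nonneg : ∀ x {y} → 0# ≤ y → x ≤ x + y
    ≤-+-nonneg x 0≤y = ≤.≤-respˡ-≈ (R.+-identityʳ x) (+-monoʳ-≤ x 0≤y)

    +-nonneg : ∀ {x y} → 0# ≤ x → 0# ≤ y → 0# ≤ x + y
    +-nonneg 0≤x 0≤y = ≤.trans 0≤x (≤-+-nonneg _ 0≤y)

    fromℕ-nonneg : ∀ n → 0# ≤ fromℕ n
    fromℕ-nonneg zero    = inj₂ R.refl
    fromℕ-nonneg (suc n) = +-nonneg (inj₁ 0<1) (fromℕ-nonneg n)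

    fromℕ-pos : ∀ n → 0# < fromℕ (suc n)
    fromℕ-pos n = <-≤-trans 0<1 (≤-+-nonneg 1# (fromℕ-nonneg n))

    *-nonneg : ∀ {x y} → 0# ≤ x → 0# < y → 0# ≤ x * y
    *-nonneg (inj₁ 0<x) 0<y = inj₁ (*-pos _ _ 0<x 0<y)
    *-nonneg (inj₂ 0≈x) 0<y =
      inj₂ (R.trans (R.sym (R.zeroˡ _)) (R.*-congʳ 0≈x))

    ⁻¹-pos : ∀ {x} → 0# < x → 0# < x ⁻¹
    ⁻¹-pos {x} 0<x with O.compare 0# (x ⁻¹)
    ... | tri< 0<x⁻¹ _ _ = 0<x⁻¹
    ... | tri≈ _ 0≈x⁻¹ _ = contradiction 0<1 (O.irrefl
      (R.trans (R.sym (R.zeroʳ x))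
      (R.trans (R.*-congˡ 0≈x⁻¹) (*-inverseʳ x λ x≈0 → O.irrefl (R.sym x≈0) 0<x))))
    ... | tri> _ _ x⁻¹<0 = contradiction
      (O.<-respˡ-≈ (R.+-identityˡ 1#) (O.<-respʳ-≈ (R.-‿inverseˡ 1#)
        (+-monoˡ-< 0# (- 1#) 1# (O.<-respʳ-≈ x*-x⁻¹≈-1 (*-pos _ _ 0<x 0<-x⁻¹)))))
      (O.asym 0<1)
      where
      0<-x⁻¹ : 0# < - (x ⁻¹)
      0<-x⁻¹ = O.<-respˡ-≈ (R.-‿inverseʳ (x ⁻¹))
        (O.<-respʳ-≈ (R.+-identityˡ _) (+-monoˡ-< _ _ (- (x ⁻¹)) x⁻¹<0))

      x*-x⁻¹≈-1 : x * - (x ⁻¹) ≈ - 1#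
      x*-x⁻¹≈-1 = R.trans (R.sym (RP.-‿distribʳ-* x (x ⁻¹)))
        (R.-‿cong (*-inverseʳ x λ x≈0 → O.irrefl (R.sym x≈0) 0<x))

    !-pos : ∀ n → 0# < fromℕ (n !)
    !-pos zero    = fromℕ-pos 0
    !-pos (suc n) = O.<-respʳ-≈ (R.sym (M.×1-homo-* (suc n) (n !)))
      (*-pos _ _ (fromℕ-pos n) (!-pos n))

    1/! : ℕ → Carrier
    1/! k = 1# / fromℕ (k !)

    1/!-pos : ∀ k → 0# < 1/! k
    1/!-pos k = *-pos _ _ 0<1 (⁻¹-pos (!-pos k))

    1/!-suc : ∀ k → fromℕ (suc k) * 1/! (suc k) ≈ 1/! k
    1/!-suc k = begin
      c * (1# * G⁻¹)             ≈⟨ R.*-congˡ (R.*-identityˡ G⁻¹) ⟩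
      c * G⁻¹                    ≈⟨ R.*-identityˡ _ ⟨
      1# * (c * G⁻¹)             ≈⟨ R.*-congʳ (inv (!-pos k)) ⟨
      (F * F ⁻¹) * (c * G⁻¹)     ≈⟨ R.*-congʳ (R.*-comm F (F ⁻¹)) ⟩
      (F ⁻¹ * F) * (c * G⁻¹)     ≈⟨ R.*-assoc _ _ _ ⟩
      F ⁻¹ * (F * (c * G⁻¹))     ≈⟨ R.*-congˡ (R.*-assoc F c G⁻¹) ⟨
      F ⁻¹ * ((F * c) * G⁻¹)     ≈⟨ R.*-congˡ (R.*-congʳ (R.*-comm F c)) ⟩
      F ⁻¹ * ((c * F) * G⁻¹)     ≈⟨ R.*-congˡ (R.*-congʳ (M.×1-homo-* (suc k) (k !))) ⟨
      F ⁻¹ * (G * G⁻¹)           ≈⟨ R.*-congˡ (inv (!-pos (suc k))) ⟩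
      F ⁻¹ * 1#                  ≈⟨ R.*-comm _ _ ⟩
      1# * F ⁻¹                  ∎
      where
      open import Relation.Binary.Reasoning.Setoid R.setoid
      c F G G⁻¹ : Carrier
      c   = fromℕ (suc k)
      F   = fromℕ (k !)
      G   = fromℕ (suc k !)
      G⁻¹ = G ⁻¹

      inv : ∀ {x} → 0# < x → x * x ⁻¹ ≈ 1#
      inv 0<x = *-inverseʳ _ λ x≈0 → O.irrefl (R.sym x≈0) 0<x

    1/!-half : ∀ k → 1/! (suc (suc k)) + 1/! (suc (suc k)) ≤ 1/! (suc k)
    1/!-half k = ≤.≤-respʳ-≈ eq
      (+-monoʳ-≤ a (≤-+-nonneg a (*-nonneg (fromℕ-nonneg k) (1/!-pos (suc (suc k))))))
      where
      a : Carrier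
      a = 1/! (suc (suc k))

      step : ∀ n → a + fromℕ n * a ≈ fromℕ (suc n) * a
      step n = R.trans (R.+-congʳ (R.sym (R.*-identityˡ a)))
                       (R.sym (R.distribʳ a 1# (fromℕ n)))

      eq : a + (a + fromℕ k * a) ≈ 1/! (suc k)
      eq = R.trans (R.+-congˡ (step k)) (R.trans (step (suc k)) (1/!-suc (suc k)))

    sum-halving : (f : ℕ → Carrier) → (∀ k → 0# ≤ f k) →
                  (∀ k → f (suc k) + f (suc k) ≤ f k) →
                  ∀ n → sum (λ (j : Fin n) → f (toℕ j)) ≤ f 0 + f 0
    sum-halving f 0≤f half zero    = +-nonneg (0≤f 0) (0≤f 0)
    sum-halving f 0≤f half (suc n) = +-monoʳ-≤ (f 0)
      (≤.trans (sum-halving (λ k → f (suc k)) (λ k → 0≤f (suc k))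
                              (λ k → half (suc k)) n)
                 (half 0))

  e-partialSum : ℕ → Carrier
  e-partialSum n = sum (λ (k : Fin n) → 1# / fromℕ (toℕ k !))

  -- e = ∑ 1/k!, a series of positive terms, as the supremum of its partial
  -- sums.

  e : Carrier
  e = proj₁ (supremum S (0# , 0 , R.refl) (_ , bound))
    where
    S : Pred Carrier 0ℓ
    S x = ∃ λ n → x ≈ e-partialSum n

    partialSum≤ : ∀ n → e-partialSum n ≤ 1/! 0 + (1/! 1 + 1/! 1)
    partialSum≤ zero    = +-nonneg (inj₁ (1/!-pos 0))
      (+-nonneg (inj₁ (1/!-pos 1)) (inj₁ (1/!-pos 1)))
    partialSum≤ (suc n) = +-monoʳ-≤ (1/! 0)
      (sum-halving (λ k → 1/! (suc k)) (λ k → inj₁ (1/!-pos (suc k))) 1/!-half n)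

    bound : IsUpperBound S (1/! 0 + (1/! 1 + 1/! 1))
    bound x (n , x≈) = ≤.≤-respˡ-≈ (R.sym x≈) (partialSum≤ n)

{-# OPTIONS --safe #-}
module Submission where

open import Defs
open import Algebra.Bundles using (CommutativeRing)
import Algebra.Construct.NaturalChoice.Max as Max
import Algebra.Properties.CommutativeMonoid.Sum as Product
import Algebra.Properties.CommutativeSemiring.Exp as Exp
import Algebra.Properties.Semiring.Mult as Mult
import Algebra.Properties.Semiring.Sum as FiniteSum
import Algebra.Solver.Ring.NaturalCoefficients.Default as Solver
open import Data.Fin.Base using (Fin; zero; suc; toℕ)
import Data.Fin.Properties as Fin
open import Data.Nat.Base as ℕ using (ℕ; zero; suc; _!; _∸_)
import Data.Nat.Properties as ℕ
open import Data.Product.Base using (∃; _×_; _,_; proj₁; proj₂)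
open import Data.Sum.Base as Sum using (_⊎_; inj₁; inj₂)
open import Data.Vec.Functional using (removeAt)
import Relation.Binary.Construct.Add.Supremum.NonStrict as AddSupremum
open import Relation.Binary.Bundles using (StrictTotalOrder; DecTotalOrder)
open import Relation.Binary.Definitions using (tri<; tri≈; tri>)
open import Relation.Binary.Properties.StrictTotalOrder using (decTotalOrder)
open import Relation.Binary.PropositionalEquality.Core as ≡ using (_≡_; _≢_)
open import Relation.Nullary.Construct.Add.Supremum using ([_]; ⊤⁺)
open import Relation.Nullary.Decidable.Core using (yes; no)
open import Relation.Nullary.Negation.Core using (¬_; contradiction)

-- Fix the prediction h = 0, and let the frontier of a ray be the farthest point
-- searched on it so far (d₀ if nothing beyond d₀ was searched).  Let S be the
-- sum of the lengths of the iterations so far.  Since every ray is extended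
-- again, S is always at most c̃ times the frontier f₀ of ray 0, and at most β
-- times the frontier of any other ray if the robustness is at most 1 + 2β.  If
-- O is the part of S spent on the n = m - 1 other rays, then O + f₀ ≤ S ≤ c̃ f₀
-- eventually, so that O ≤ (c̃ - 1) f₀ and κ O ≤ S for κ = 1 + 1 / (c̃ - 1);
-- hence μ O ≤ f with μ = κ / β for the frontiers f of all other rays.  In
-- particular their product P satisfies P ≥ μⁿ Oⁿ.  On the other hand the
-- quotient P / Oⁿ never increases, and by the AM-GM inequality ρ*ₙ x Oⁿ⁻¹ ≤ (O
-- + x)ⁿ it is divided by at least ρ*ₙ μ whenever one of the other rays is
-- extended.  Therefore ρ*ₙ μ ≤ 1, that is ρ*ₙ κ ≤ β.
--
-- For the asymptotics, comparing the partial sums of the exponential series at y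
-- and at y + x by Bernoulli's inequality gives e (n - 1) ≤ ρ*ₙ ≤ e n.

-- Arithmetic in an ordered field.

module OrderedField (ℝ : CompleteOrderedField) where

  open Search ℝ public
  open CommutativeRing commutativeRing public
    using (refl; sym; trans; reflexive; +-cong; +-congˡ; +-congʳ; *-cong; *-congˡ; *-congʳ;
           +-comm; *-comm; +-assoc; *-assoc; +-identityˡ; +-identityʳ;
           *-identityˡ; *-identityʳ; zeroˡ; zeroʳ; distribˡ; distribʳ;
           -‿inverseˡ; -‿inverseʳ; *-commutativeMonoid; commutativeSemiring; semiring)
  open StrictTotalOrder strictTotalOrder public
    using (compare; _<?_; <-respˡ-≈; <-respʳ-≈; irrefl; asym; strictPartialOrder)
    renaming (trans to <-trans)
  open DecTotalOrder (decTotalOrder strictTotalOrder) public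
    using (≤-respˡ-≈; ≤-respʳ-≈; antisym; totalOrder)
    renaming (refl to ≤-refl; trans to ≤-trans; total to ≤-total)
  open Exp commutativeSemiring public using (_^_; ^-congˡ; ^-distrib-*)
  open Mult semiring public using (×1-homo-*)
  open FiniteSum semiring public
    using (sum-cong-≋; sum-replicate-zero; ∑-distrib-+; *-distribˡ-sum)
  open Product *-commutativeMonoid public
    using () renaming (sum to product; sum-cong-≋ to product-cong; sum-remove to product-remove)
  open Solver commutativeSemiring public
    using (solve; _:=_; _:+_; _:*_; con)
  open import Relation.Binary.Reasoning.StrictPartialOrder strictPartialOrder public

  ≮⇒≥ : ∀ {x y} → ¬ x < y → y ≤ x
  ≮⇒≥ {x} {y} x≮y with compare x y
  ... | tri< x<y _ _ = contradiction x<y x≮y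
  ... | tri≈ _ x≈y _ = inj₂ (sym x≈y)
  ... | tri> _ _ y<x = inj₁ y<x

  <⇒≱ : ∀ {x y} → x < y → ¬ y ≤ x
  <⇒≱ x<y (inj₁ y<x) = asym x<y y<x
  <⇒≱ x<y (inj₂ y≈x) = irrefl (sym y≈x) x<y

  <-≤-trans : ∀ {x y z} → x < y → y ≤ z → x < z
  <-≤-trans x<y (inj₁ y<z) = <-trans x<y y<z
  <-≤-trans x<y (inj₂ y≈z) = <-respʳ-≈ y≈z x<y

  <⇒≉0 : ∀ {x} → 0# < x → ¬ x ≈ 0#
  <⇒≉0 0<x x≈0 = irrefl (sym x≈0) 0<x

  +-monoʳ-< : ∀ z {x y} → x < y → z + x < z + y
  +-monoʳ-< z {x} {y} x<y =
    <-respʳ-≈ (+-comm y z) (<-respˡ-≈ (+-comm x z) (+-monoˡ-< x y z x<y))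

  +-monoʳ-≤ : ∀ z {x y} → x ≤ y → z + x ≤ z + y
  +-monoʳ-≤ z (inj₁ x<y) = inj₁ (+-monoʳ-< z x<y)
  +-monoʳ-≤ z (inj₂ x≈y) = inj₂ (+-congˡ x≈y)

  +-monoˡ-≤ : ∀ z {x y} → x ≤ y → x + z ≤ y + z
  +-monoˡ-≤ z (inj₁ x<y) = inj₁ (+-monoˡ-< _ _ z x<y)
  +-monoˡ-≤ z (inj₂ x≈y) = inj₂ (+-congʳ x≈y)

  +-mono-≤ : ∀ {w x y z} → w ≤ x → y ≤ z → w + y ≤ x + z
  +-mono-≤ w≤x y≤z = ≤-trans (+-monoˡ-≤ _ w≤x) (+-monoʳ-≤ _ y≤z)

  +-cancelʳ-≤ : ∀ z {x y} → x + z ≤ y + z → x ≤ y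
  +-cancelʳ-≤ z x+z≤y+z = ≮⇒≥ λ y<x → <⇒≱ (+-monoˡ-< _ _ z y<x) x+z≤y+z

  x≤x+y : ∀ {x y} → 0# ≤ y → x ≤ x + y
  x≤x+y 0≤y = ≤-respˡ-≈ (+-identityʳ _) (+-monoʳ-≤ _ 0≤y)

  x≤y+x : ∀ {x y} → 0# ≤ y → x ≤ y + x
  x≤y+x 0≤y = ≤-respˡ-≈ (+-identityˡ _) (+-monoˡ-≤ _ 0≤y)

  x<x+y : ∀ {x y} → 0# < y → x < x + y
  x<x+y 0<y = <-respˡ-≈ (+-identityʳ _) (+-monoʳ-< _ 0<y)

  +-nonneg : ∀ {x y} → 0# ≤ x → 0# ≤ y → 0# ≤ x + y
  +-nonneg 0≤x 0≤y = ≤-trans 0≤x (x≤x+y 0≤y)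

  x-y+y≈x : ∀ x y → (x - y) + y ≈ x
  x-y+y≈x x y = trans (+-assoc x (- y) y) (trans (+-congˡ (-‿inverseˡ y)) (+-identityʳ x))

  x<y⇒0<y-x : ∀ {x y} → x < y → 0# < y - x
  x<y⇒0<y-x {x} {y} x<y = <-respˡ-≈ (-‿inverseʳ x) (+-monoˡ-< x y (- x) x<y)

  x≤y⇒0≤y-x : ∀ {x y} → x ≤ y → 0# ≤ y - x
  x≤y⇒0≤y-x {x} {y} x≤y = ≤-respˡ-≈ (-‿inverseʳ x) (+-monoˡ-≤ (- x) x≤y)

  *-monoʳ-< : ∀ {z x y} → 0# < z → x < y → z * x < z * y
  *-monoʳ-< {z} {x} {y} 0<z x<y = begin-strict
    z * x                ≈⟨ +-identityˡ _ ⟨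
    0# + z * x           <⟨ +-monoˡ-< _ _ _ (*-pos _ _ 0<z (x<y⇒0<y-x x<y)) ⟩
    z * (y - x) + z * x  ≈⟨ distribˡ z (y - x) x ⟨
    z * ((y - x) + x)    ≈⟨ *-congˡ (x-y+y≈x y x) ⟩
    z * y                ∎

  *-monoʳ-≤ : ∀ {z x y} → 0# ≤ z → x ≤ y → z * x ≤ z * y
  *-monoʳ-≤ (inj₁ 0<z) (inj₁ x<y) = inj₁ (*-monoʳ-< 0<z x<y)
  *-monoʳ-≤ 0≤z        (inj₂ x≈y) = inj₂ (*-congˡ x≈y)
  *-monoʳ-≤ (inj₂ 0≈z) _          = inj₂
    (trans (*-congʳ (sym 0≈z)) (trans (zeroˡ _) (trans (sym (zeroˡ _)) (*-congʳ 0≈z))))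

  *-monoˡ-≤ : ∀ {z x y} → 0# ≤ z → x ≤ y → x * z ≤ y * z
  *-monoˡ-≤ 0≤z x≤y = ≤-respˡ-≈ (*-comm _ _) (≤-respʳ-≈ (*-comm _ _) (*-monoʳ-≤ 0≤z x≤y))

  *-mono-≤ : ∀ {w x y z} → 0# ≤ x → 0# ≤ y → w ≤ x → y ≤ z → w * y ≤ x * z
  *-mono-≤ 0≤x 0≤y w≤x y≤z = ≤-trans (*-monoˡ-≤ 0≤y w≤x) (*-monoʳ-≤ 0≤x y≤z)

  *-nonneg : ∀ {x y} → 0# ≤ x → 0# ≤ y → 0# ≤ x * y
  *-nonneg 0≤x 0≤y = ≤-respˡ-≈ (zeroʳ _) (*-monoʳ-≤ 0≤x 0≤y)

  *-cancelˡ-≤ : ∀ {z x y} → 0# < z → z * x ≤ z * y → x ≤ y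
  *-cancelˡ-≤ 0<z zx≤zy = ≮⇒≥ λ y<x → <⇒≱ (*-monoʳ-< 0<z y<x) zx≤zy

  *-cancelˡ-< : ∀ {z x y} → 0# ≤ z → z * x < z * y → x < y
  *-cancelˡ-< {z} {x} {y} 0≤z zx<zy with compare x y
  ... | tri< x<y _ _ = x<y
  ... | tri≈ _ x≈y _ = contradiction (*-monoʳ-≤ 0≤z (inj₂ (sym x≈y))) (<⇒≱ zx<zy)
  ... | tri> _ _ y<x = contradiction (*-monoʳ-≤ 0≤z (inj₁ y<x)) (<⇒≱ zx<zy)

  *-cancelˡ-≈ : ∀ {z x y} → 0# < z → z * x ≈ z * y → x ≈ y
  *-cancelˡ-≈ 0<z zx≈zy =
    antisym (*-cancelˡ-≤ 0<z (inj₂ zx≈zy)) (*-cancelˡ-≤ 0<z (inj₂ (sym zx≈zy)))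

  0≤1 : 0# ≤ 1#
  0≤1 = inj₁ 0<1

  1^k≈1 : ∀ k → 1# ^ k ≈ 1#
  1^k≈1 zero    = refl
  1^k≈1 (suc k) = trans (*-identityˡ _) (1^k≈1 k)

  sum-mono-≤ : ∀ {n} {f g : Fin n → Carrier} → (∀ i → f i ≤ g i) → sum f ≤ sum g
  sum-mono-≤ {zero}  f≤g = ≤-refl
  sum-mono-≤ {suc n} f≤g = +-mono-≤ (f≤g zero) (sum-mono-≤ λ i → f≤g (suc i))

  ^-pos : ∀ {x} n → 0# < x → 0# < x ^ n
  ^-pos zero    0<x = 0<1
  ^-pos (suc n) 0<x = *-pos _ _ 0<x (^-pos n 0<x)

  ^-nonneg : ∀ {x} n → 0# ≤ x → 0# ≤ x ^ n
  ^-nonneg zero    0≤x = 0≤1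
  ^-nonneg (suc n) 0≤x = *-nonneg 0≤x (^-nonneg n 0≤x)

  ^-mono-≤ : ∀ {x y} n → 0# ≤ x → x ≤ y → x ^ n ≤ y ^ n
  ^-mono-≤ zero    0≤x x≤y = ≤-refl
  ^-mono-≤ (suc n) 0≤x x≤y =
    *-mono-≤ (≤-trans 0≤x x≤y) (^-nonneg n 0≤x) x≤y (^-mono-≤ n 0≤x x≤y)

  *⁻¹-cancel : ∀ {x} → 0# < x → ∀ y → x * (y * x ⁻¹) ≈ y
  *⁻¹-cancel {x} 0<x y = begin-equality
    x * (y * x ⁻¹)  ≈⟨ solve 3 (λ x y z → x :* (y :* z) := y :* (x :* z)) refl x y (x ⁻¹) ⟩
    y * (x * x ⁻¹)  ≈⟨ *-congˡ (*-inverseʳ x (<⇒≉0 0<x)) ⟩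
    y * 1#          ≈⟨ *-identityʳ y ⟩
    y               ∎

  ⁻¹-pos : ∀ {x} → 0# < x → 0# < x ⁻¹
  ⁻¹-pos {x} 0<x = *-cancelˡ-< (inj₁ 0<x) (begin-strict
    x * 0#    ≈⟨ zeroʳ x ⟩
    0#        <⟨ 0<1 ⟩
    1#        ≈⟨ *-inverseʳ x (<⇒≉0 0<x) ⟨
    x * x ⁻¹  ∎)

  /-pos : ∀ {x y} → 0# < x → 0# < y → 0# < x / y
  /-pos 0<x 0<y = *-pos _ _ 0<x (⁻¹-pos 0<y)

  fromℕ-nonneg : ∀ n → 0# ≤ fromℕ n
  fromℕ-nonneg zero    = ≤-refl
  fromℕ-nonneg (suc n) = +-nonneg 0≤1 (fromℕ-nonneg n)

  fromℕ-suc-pos : ∀ n → 0# < fromℕ (suc n)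
  fromℕ-suc-pos n = <-≤-trans 0<1 (x≤x+y (fromℕ-nonneg n))

  fromℕ-mono-≤ : ∀ {m n} → m ℕ.≤ n → fromℕ m ≤ fromℕ n
  fromℕ-mono-≤ {n = n} ℕ.z≤n       = fromℕ-nonneg n
  fromℕ-mono-≤         (ℕ.s≤s m≤n) = +-monoʳ-≤ 1# (fromℕ-mono-≤ m≤n)

  fromℕ-homo-^ : ∀ m n → fromℕ (m ℕ.^ n) ≈ fromℕ m ^ n
  fromℕ-homo-^ m zero    = +-identityʳ 1#
  fromℕ-homo-^ m (suc n) =
    trans (×1-homo-* m (m ℕ.^ n)) (*-congˡ (fromℕ-homo-^ m n))

  dense : ∀ {x y} → x < y → ∃ λ z → x < z × z < y
  dense {x} {y} x<y = (x + y) / fromℕ 2 ,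
    *-cancelˡ-< (inj₁ 0<2) (begin-strict
      fromℕ 2 * x                ≈⟨ solve 1 (λ x → (con 1 :+ (con 1 :+ con 0)) :* x := x :+ x) refl x ⟩
      x + x                      <⟨ +-monoʳ-< x x<y ⟩
      x + y                      ≈⟨ *⁻¹-cancel 0<2 (x + y) ⟨
      fromℕ 2 * ((x + y) / fromℕ 2) ∎) ,
    *-cancelˡ-< (inj₁ 0<2) (begin-strict
      fromℕ 2 * ((x + y) / fromℕ 2)  ≈⟨ *⁻¹-cancel 0<2 (x + y) ⟩
      x + y                          <⟨ +-monoˡ-< x y y x<y ⟩
      y + y                          ≈⟨ solve 1 (λ x → x :+ x := (con 1 :+ (con 1 :+ con 0)) :* x) refl y ⟩
      fromℕ 2 * y                    ∎)
    where
    0<2 : 0# < fromℕ 2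
    0<2 = fromℕ-suc-pos 1

  -- If no natural number exceeded `x`, the naturals would have a supremum `s`; some `n` exceeds
  -- `s - 1#`, so `suc n` exceeds `s`.
  archimedean : ∀ x → ∃ λ n → x < fromℕ n
  archimedean x with excludedMiddle (∃ λ n → x < fromℕ n)
  ... | yes p = p
  ... | no ¬p = contradiction (sup-least (s - 1#) s-1<s) λ (_ , (n , y≈n) , s-1<y) →
    <⇒≱ (begin-strict
      s              ≈⟨ x-y+y≈x s 1# ⟨
      (s - 1#) + 1#  <⟨ +-monoˡ-< _ _ 1# s-1<y ⟩
      _ + 1#         ≈⟨ +-congʳ y≈n ⟩
      fromℕ n + 1#   ≈⟨ +-comm _ _ ⟩
      fromℕ (suc n)  ∎)
    (sup-upper (fromℕ (suc n)) (suc n , refl))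
    where
    S : Carrier → Set
    S y = ∃ λ n → y ≈ fromℕ n

    sup : ∃ (IsSupremum S)
    sup = supremum S (0# , 0 , refl)
      (x , λ y (n , y≈n) → ≤-respˡ-≈ (sym y≈n) (≮⇒≥ λ x<n → ¬p (n , x<n)))

    s : Carrier
    s = proj₁ sup

    sup-upper : IsUpperBound S s
    sup-upper = proj₁ (proj₂ sup)

    sup-least : ∀ y → y < s → ∃ λ x → S x × y < x
    sup-least = proj₂ (proj₂ sup)

    s-1<s : s - 1# < s
    s-1<s = <-respʳ-≈ (x-y+y≈x s 1#) (x<x+y 0<1)

  -- Bernoulli's inequality, weighted AM-GM and the constants `ρ*`.

  bernoulli : ∀ k {x y} → 0# ≤ x → 0# ≤ y →
              y ^ suc k + fromℕ (suc k) * (x * y ^ k) ≤ (y + x) ^ suc k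
  bernoulli zero {x} {y} 0≤x 0≤y = inj₂
    (solve 2 (λ x y → y :* con 1 :+ (con 1 :+ con 0) :* (x :* con 1) := (y :+ x) :* con 1)
      refl x y)
  bernoulli (suc k) {x} {y} 0≤x 0≤y = begin
    y * (y * y ^ k) + (1# + n) * (x * (y * y ^ k))
      ≤⟨ x≤x+y (*-nonneg (fromℕ-nonneg (suc k)) (*-nonneg (*-nonneg 0≤x 0≤x) (^-nonneg k 0≤y))) ⟩
    y * (y * y ^ k) + (1# + n) * (x * (y * y ^ k)) + n * (x * x * y ^ k)
      ≈⟨ solve 4 (λ x y n p →
           y :* (y :* p) :+ (con 1 :+ n) :* (x :* (y :* p)) :+ n :* (x :* x :* p) :=
           (y :+ x) :* (y :* p :+ n :* (x :* p))) refl x y n (y ^ k) ⟩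
    (y + x) * (y ^ suc k + n * (x * y ^ k))
      ≤⟨ *-monoʳ-≤ (+-nonneg 0≤y 0≤x) (bernoulli k 0≤x 0≤y) ⟩
    (y + x) ^ suc (suc k) ∎
    where n = fromℕ (suc k)

  -- Where `bernoulli` takes the slope of the power function at the left end `y`, this takes the
  -- larger slope at the right end `y + x`.
  bernoulli-upper : ∀ k {x y} → 0# ≤ x → 0# ≤ y →
                    (y + x) ^ suc k ≤ y ^ suc k + fromℕ (suc k) * (x * (y + x) ^ k)
  bernoulli-upper zero {x} {y} 0≤x 0≤y = inj₂
    (solve 2 (λ x y → (y :+ x) :* con 1 := y :* con 1 :+ (con 1 :+ con 0) :* (x :* con 1))
      refl x y)
  bernoulli-upper (suc k) {x} {y} 0≤x 0≤y = begin
    z * z ^ suc k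
      ≤⟨ *-monoʳ-≤ (+-nonneg 0≤y 0≤x) (bernoulli-upper k 0≤x 0≤y) ⟩
    z * (y ^ suc k + n * (x * z ^ k))
      ≈⟨ solve 5 (λ x y n p q →
           (y :+ x) :* (p :+ n :* (x :* q)) :=
           y :* p :+ n :* (x :* ((y :+ x) :* q)) :+ x :* p)
           refl x y n (y ^ suc k) (z ^ k) ⟩
    y * y ^ suc k + n * (x * z ^ suc k) + x * y ^ suc k
      ≤⟨ +-monoʳ-≤ _ (*-monoʳ-≤ 0≤x (^-mono-≤ (suc k) 0≤y (x≤x+y 0≤x))) ⟩
    y * y ^ suc k + n * (x * z ^ suc k) + x * z ^ suc k
      ≈⟨ solve 3 (λ n p q → p :+ n :* q :+ q := p :+ (con 1 :+ n) :* q)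
           refl n (y * y ^ suc k) (x * z ^ suc k) ⟩
    y ^ suc (suc k) + fromℕ (suc (suc k)) * (x * z ^ suc k) ∎
    where
    n = fromℕ (suc k)
    z = y + x

  -- The tangent line of u ↦ uᵖ⁺¹ at v lies below the graph, written without
  -- subtraction.
  tangent-≤ : ∀ p {u v} → 0# ≤ u → 0# ≤ v →
              fromℕ (suc p) * (u * v ^ p) ≤ u ^ suc p + fromℕ p * v ^ suc p
  tangent-≤ p {u} {v} 0≤u 0≤v with ≤-total v u
  ... | inj₁ v≤u = begin
    (1# + n) * (u * v ^ p)
      ≈⟨ *-congˡ (*-congʳ v+x≈u) ⟨
    (1# + n) * ((v + x) * v ^ p)
      ≈⟨ solve 4 (λ x v n p → (con 1 :+ n) :* ((v :+ x) :* p) :=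
           (v :* p :+ (con 1 :+ n) :* (x :* p)) :+ n :* (v :* p)) refl x v n (v ^ p) ⟩
    (v ^ suc p + fromℕ (suc p) * (x * v ^ p)) + n * v ^ suc p
      ≤⟨ +-monoˡ-≤ _ (bernoulli p 0≤x 0≤v) ⟩
    (v + x) ^ suc p + n * v ^ suc p
      ≈⟨ +-congʳ (^-congˡ (suc p) v+x≈u) ⟩
    u ^ suc p + n * v ^ suc p ∎
    where
    n = fromℕ p
    x = u - v
    v+x≈u : v + x ≈ u
    v+x≈u = trans (+-comm v x) (x-y+y≈x u v)
    0≤x : 0# ≤ x
    0≤x = x≤y⇒0≤y-x v≤u
  -- Now `v` is the right end of the interval, so `bernoulli-upper` has the slope at `v`; the term
  -- added on both sides replaces a subtraction.
  ... | inj₂ u≤v = +-cancelʳ-≤ (fromℕ (suc p) * (x * v ^ p)) (begin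
    (1# + n) * (u * v ^ p) + (1# + n) * (x * v ^ p)
      ≈⟨ solve 4 (λ x u n p → (con 1 :+ n) :* (u :* p) :+ (con 1 :+ n) :* (x :* p) :=
           (u :+ x) :* p :+ n :* ((u :+ x) :* p)) refl x u n (v ^ p) ⟩
    (u + x) * v ^ p + n * ((u + x) * v ^ p)
      ≈⟨ +-cong (*-congʳ u+x≈v) (*-congˡ (*-congʳ u+x≈v)) ⟩
    v ^ suc p + n * v ^ suc p
      ≈⟨ +-congʳ (^-congˡ (suc p) u+x≈v) ⟨
    (u + x) ^ suc p + n * v ^ suc p
      ≤⟨ +-monoˡ-≤ _ (bernoulli-upper p 0≤x 0≤u) ⟩
    (u ^ suc p + (1# + n) * (x * (u + x) ^ p)) + n * v ^ suc p
      ≈⟨ +-congʳ (+-congˡ (*-congˡ (*-congˡ (^-congˡ p u+x≈v)))) ⟩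
    (u ^ suc p + (1# + n) * (x * v ^ p)) + n * v ^ suc p
      ≈⟨ solve 3 (λ a b c → (a :+ b) :+ c := (a :+ c) :+ b) refl _ _ _ ⟩
    (u ^ suc p + n * v ^ suc p) + (1# + n) * (x * v ^ p) ∎)
    where
    n = fromℕ p
    x = v - u
    u+x≈v : u + x ≈ v
    u+x≈v = trans (+-comm u x) (x-y+y≈x v u)
    0≤x : 0# ≤ x
    0≤x = x≤y⇒0≤y-x u≤v

  -- AM-GM for `x` and `p` copies of `s / p`. It is the tangent inequality at `u = p (s + x)` and
  -- `v = (p + 1) s`, which coincide in the case of equality `s = p x`. The case `zero` is separate
  -- because a factor `fromℕ p` is cancelled.
  weighted-AM-GM : ∀ p {x s} → 0# ≤ x → 0# ≤ s →
                   fromℕ (suc p) ^ suc p * (x * s ^ p) ≤ fromℕ p ^ p * (s + x) ^ suc p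
  weighted-AM-GM zero {x} {s} 0≤x 0≤s = begin
    (1# + 0#) * 1# * (x * 1#)  ≈⟨ solve 1 (λ x → (con 1 :+ con 0) :* con 1 :* (x :* con 1) := x) refl x ⟩
    x                          ≤⟨ x≤y+x 0≤s ⟩
    s + x                      ≈⟨ solve 1 (λ x → x := con 1 :* (x :* con 1)) refl (s + x) ⟩
    1# * ((s + x) * 1#)        ∎
  weighted-AM-GM p@(suc p-1) {x} {s} 0≤x 0≤s =
    +-cancelʳ-≤ (Q ^ suc p * s ^ suc p) (*-cancelˡ-≤ 0<P (begin
      P * (Q ^ suc p * (x * s ^ p) + Q ^ suc p * s ^ suc p)
        ≈⟨ solve 6 (λ P Q x s Qᵖ sᵖ →
             P :* (Q :* Qᵖ :* (x :* sᵖ) :+ Q :* Qᵖ :* (s :* sᵖ)) :=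
             Q :* (P :* (s :+ x) :* (Qᵖ :* sᵖ)))
             refl P Q x s (Q ^ p) (s ^ p) ⟩
      Q * (P * (s + x) * (Q ^ p * s ^ p))
        ≈⟨ *-congˡ (*-congˡ (^-distrib-* Q s p)) ⟨
      Q * (P * (s + x) * (Q * s) ^ p)
        ≤⟨ tangent-≤ p (*-nonneg 0≤P (+-nonneg 0≤s 0≤x)) (*-nonneg (fromℕ-nonneg (suc p)) 0≤s) ⟩
      (P * (s + x)) ^ suc p + P * (Q * s) ^ suc p
        ≈⟨ +-cong (^-distrib-* P (s + x) (suc p)) (*-congˡ (^-distrib-* Q s (suc p))) ⟩
      P ^ suc p * (s + x) ^ suc p + P * (Q ^ suc p * s ^ suc p)
        ≈⟨ solve 4 (λ P Pᵖ a b → P :* Pᵖ :* a :+ P :* b := P :* (Pᵖ :* a :+ b))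
             refl P (P ^ p) ((s + x) ^ suc p) (Q ^ suc p * s ^ suc p) ⟩
      P * (P ^ p * (s + x) ^ suc p + Q ^ suc p * s ^ suc p) ∎))
    where
    P = fromℕ p
    Q = fromℕ (suc p)
    0<P : 0# < P
    0<P = fromℕ-suc-pos p-1
    0≤P : 0# ≤ P
    0≤P = inj₁ 0<P

  -- At `p = 0` the power is 1, so `ρ*-cancel` holds there too.
  fromℕ-^-self-pos : ∀ p → 0# < fromℕ p ^ p
  fromℕ-^-self-pos zero    = 0<1
  fromℕ-^-self-pos (suc p) = ^-pos (suc p) (fromℕ-suc-pos p)

  ρ*-cancel : ∀ p → fromℕ p ^ p * ρ* (suc p) ≈ fromℕ (suc p) ^ suc p
  ρ*-cancel p = begin-equality
    fromℕ p ^ p * ρ* (suc p)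
      ≈⟨ *-congʳ (fromℕ-homo-^ p p) ⟨
    fromℕ (p ℕ.^ p) * ρ* (suc p)
      ≈⟨ *⁻¹-cancel (<-respʳ-≈ (sym (fromℕ-homo-^ p p)) (fromℕ-^-self-pos p)) _ ⟩
    fromℕ (suc p ℕ.^ suc p)
      ≈⟨ fromℕ-homo-^ (suc p) (suc p) ⟩
    fromℕ (suc p) ^ suc p ∎

  ρ*-pos : ∀ p → 0# < ρ* (suc p)
  ρ*-pos p = *-cancelˡ-< (inj₁ (fromℕ-^-self-pos p)) (begin-strict
    fromℕ p ^ p * 0#          ≈⟨ zeroʳ _ ⟩
    0#                        <⟨ fromℕ-^-self-pos (suc p) ⟩
    fromℕ (suc p) ^ suc p     ≈⟨ ρ*-cancel p ⟨
    fromℕ p ^ p * ρ* (suc p)  ∎)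

  -- Weighted AM-GM divided by `p ^ p`; equality at `s = p x` makes `ρ*` the best constant. This and
  -- positivity are all that the search argument uses of `ρ*`.
  ρ*-≤ : ∀ p {x s} → 0# ≤ x → 0# ≤ s → ρ* (suc p) * (x * s ^ p) ≤ (s + x) ^ suc p
  ρ*-≤ p {x} {s} 0≤x 0≤s = *-cancelˡ-≤ (fromℕ-^-self-pos p) (begin
    fromℕ p ^ p * (ρ* (suc p) * (x * s ^ p))  ≈⟨ *-assoc _ _ _ ⟨
    fromℕ p ^ p * ρ* (suc p) * (x * s ^ p)    ≈⟨ *-congʳ (ρ*-cancel p) ⟩
    fromℕ (suc p) ^ suc p * (x * s ^ p)       ≤⟨ weighted-AM-GM p 0≤x 0≤s ⟩
    fromℕ p ^ p * (s + x) ^ suc p             ∎)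

-- The bounds e (n - 1) ≤ ρ*ₙ ≤ e n.

module EulerNumber (ℝ : CompleteOrderedField) where

  open OrderedField ℝ

  sum-linear : ∀ {n} (f g : Fin n → Carrier) x →
               sum (λ i → f i + x * g i) ≈ sum f + x * sum g
  sum-linear {n} f g x = trans (∑-distrib-+ f (λ i → x * g i)) (+-congˡ (sym (*-distribˡ-sum x g)))

  1/! : ℕ → Carrier
  1/! k = 1# / fromℕ (k !)

  !-pos : ∀ k → 0# < fromℕ (k !)
  !-pos zero    = fromℕ-suc-pos 0
  !-pos (suc k) = <-respʳ-≈ (sym (×1-homo-* (suc k) (k !))) (*-pos _ _ (fromℕ-suc-pos k) (!-pos k))

  1/!-nonneg : ∀ k → 0# ≤ 1/! k
  1/!-nonneg k = inj₁ (/-pos 0<1 (!-pos k))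

  1/!-suc : ∀ k → 1/! k ≈ fromℕ (suc k) * 1/! (suc k)
  1/!-suc k = *-cancelˡ-≈ (!-pos k) (begin-equality
    fromℕ (k !) * 1/! k
      ≈⟨ *⁻¹-cancel (!-pos k) 1# ⟩
    1#
      ≈⟨ *⁻¹-cancel (!-pos (suc k)) 1# ⟨
    fromℕ (suc k !) * 1/! (suc k)
      ≈⟨ *-congʳ (×1-homo-* (suc k) (k !)) ⟩
    fromℕ (suc k) * fromℕ (k !) * 1/! (suc k)
      ≈⟨ solve 3 (λ a b c → a :* b :* c := b :* (a :* c)) refl _ _ _ ⟩
    fromℕ (k !) * (fromℕ (suc k) * 1/! (suc k)) ∎)

  1/0!≈1 : 1/! 0 ≈ 1#
  1/0!≈1 = begin-equality
    1/! 0              ≈⟨ 1/!-suc 0 ⟩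
    fromℕ 1 * 1/! 1    ≈⟨ *⁻¹-cancel (!-pos 1) 1# ⟩
    1#                 ∎

  expTerm : ℕ → Carrier → Carrier
  expTerm k y = y ^ k * 1/! k

  -- Only the first `N` terms of the exponential series, so that all estimates are termwise; a limit
  -- enters only through the supremum `e`.
  exp : ℕ → Carrier → Carrier
  exp N y = sum (λ (k : Fin N) → expTerm (toℕ k) y)

  expTerm-nonneg : ∀ k {y} → 0# ≤ y → 0# ≤ expTerm k y
  expTerm-nonneg k 0≤y = *-nonneg (^-nonneg k 0≤y) (1/!-nonneg k)

  exp-cong : ∀ N {x y} → x ≈ y → exp N x ≈ exp N y
  exp-cong N x≈y = sum-cong-≋ {N} λ k → *-congʳ (^-congˡ (toℕ k) x≈y)

  exp-mono : ∀ N {y} → 0# ≤ y → exp N y ≤ exp (suc N) y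
  exp-mono N {y} 0≤y = go N 0
    where
    -- The offset `i` lets the induction peel terms off the front although the additional term is
    -- the last one.
    go : ∀ N i → sum (λ (k : Fin N) → expTerm (i ℕ.+ toℕ k) y) ≤
                 sum (λ (k : Fin (suc N)) → expTerm (i ℕ.+ toℕ k) y)
    go zero    i = +-nonneg (expTerm-nonneg (i ℕ.+ 0) 0≤y) ≤-refl
    go (suc N) i = +-monoʳ-≤ _ (≤-trans (inj₂ (sum-cong-≋ {N} λ k → shift (toℕ k)))
      (≤-trans (go N (suc i)) (inj₂ (sum-cong-≋ {suc N} λ k → sym (shift (toℕ k))))))
      where
      shift : ∀ k → expTerm (i ℕ.+ suc k) y ≈ expTerm (suc i ℕ.+ k) y
      shift k rewrite ℕ.+-suc i k = refl

  -- The derivative of the term of degree `k + 1` is the term of degree `k`; pulling out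
  -- `1/! (suc k)` leaves the expressions in the two Bernoulli inequalities.
  expTerm-derivative : ∀ k a b x → a * 1/! (suc k) + x * (b * 1/! k) ≈
                       (a + fromℕ (suc k) * (x * b)) * 1/! (suc k)
  expTerm-derivative k a b x = begin-equality
    a * 1/! (suc k) + x * (b * 1/! k)
      ≈⟨ +-congˡ (*-congˡ (*-congˡ (1/!-suc k))) ⟩
    a * 1/! (suc k) + x * (b * (fromℕ (suc k) * 1/! (suc k)))
      ≈⟨ solve 5 (λ a b x n c → a :* c :+ x :* (b :* (n :* c)) := (a :+ n :* (x :* b)) :* c)
           refl a b x (fromℕ (suc k)) (1/! (suc k)) ⟩
    (a + fromℕ (suc k) * (x * b)) * 1/! (suc k) ∎

  -- `bernoulli` term by term: the derivative of the truncated series has one term fewer, and the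
  -- constant terms agree.
  exp-+-≥ : ∀ N {x y} → 0# ≤ x → 0# ≤ y →
            exp (suc N) y + x * exp N y ≤ exp (suc N) (y + x)
  exp-+-≥ N {x} {y} 0≤x 0≤y = begin
    exp (suc N) y + x * exp N y
      ≈⟨ +-assoc _ _ _ ⟩
    expTerm 0 y + (sum (λ (k : Fin N) → expTerm (suc (toℕ k)) y) + x * exp N y)
      ≈⟨ +-congˡ (sum-linear {N} _ _ x) ⟨
    expTerm 0 y + sum (λ (k : Fin N) → expTerm (suc (toℕ k)) y + x * expTerm (toℕ k) y)
      ≤⟨ +-monoʳ-≤ _ (sum-mono-≤ {N} λ k → term (toℕ k)) ⟩
    exp (suc N) (y + x) ∎
    where
    term : ∀ k → expTerm (suc k) y + x * expTerm k y ≤ expTerm (suc k) (y + x)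
    term k = ≤-respˡ-≈ (sym (expTerm-derivative k _ _ x))
      (*-monoˡ-≤ (1/!-nonneg (suc k)) (bernoulli k 0≤x 0≤y))

  -- `bernoulli-upper` term by term. The final enlargement by `exp-mono` leaves a single truncation,
  -- so that the estimate can be iterated with `N` fixed.
  exp-+-≤ : ∀ N {x y} → 0# ≤ x → 0# ≤ y →
            exp N (y + x) ≤ exp N y + x * exp N (y + x)
  exp-+-≤ zero {x} 0≤x 0≤y = inj₂ (sym (trans (+-identityˡ _) (zeroʳ x)))
  exp-+-≤ (suc N) {x} {y} 0≤x 0≤y = begin
    exp (suc N) (y + x)
      ≤⟨ +-monoʳ-≤ _ (sum-mono-≤ {N} λ k → term (toℕ k)) ⟩
    expTerm 0 y + sum (λ (k : Fin N) → expTerm (suc (toℕ k)) y + x * expTerm (toℕ k) (y + x))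
      ≈⟨ +-congˡ (sum-linear {N} _ _ x) ⟩
    expTerm 0 y + (sum (λ (k : Fin N) → expTerm (suc (toℕ k)) y) + x * exp N (y + x))
      ≈⟨ +-assoc _ _ _ ⟨
    exp (suc N) y + x * exp N (y + x)
      ≤⟨ +-monoʳ-≤ _ (*-monoʳ-≤ 0≤x (exp-mono N (+-nonneg 0≤y 0≤x))) ⟩
    exp (suc N) y + x * exp (suc N) (y + x) ∎
    where
    term : ∀ k → expTerm (suc k) (y + x) ≤ expTerm (suc k) y + x * expTerm k (y + x)
    term k = ≤-respʳ-≈ (sym (expTerm-derivative k _ _ x))
      (*-monoˡ-≤ (1/!-nonneg (suc k)) (bernoulli-upper k 0≤x 0≤y))

  exp-at-0 : ∀ N {y} → y ≈ 0# → exp N y ≤ 1#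
  exp-at-0 zero    y≈0 = 0≤1
  exp-at-0 (suc N) {y} y≈0 = inj₂ (begin-equality
    1# * 1/! 0 + sum (λ (k : Fin N) → expTerm (suc (toℕ k)) y)
      ≈⟨ +-cong (trans (*-identityˡ _) 1/0!≈1)
           (sum-cong-≋ {N} λ k → trans (*-congʳ (trans (*-congʳ y≈0) (zeroˡ _))) (zeroˡ _)) ⟩
    1# + sum (λ (k : Fin N) → 0#)
      ≈⟨ +-congˡ (sum-replicate-zero N) ⟩
    1# + 0#
      ≈⟨ +-identityʳ 1# ⟩
    1# ∎)

  fromℕ-suc-* : ∀ j x → fromℕ (suc j) * x ≈ fromℕ j * x + x
  fromℕ-suc-* j x = solve 2 (λ n x → (con 1 :+ n) :* x := n :* x :+ x) refl (fromℕ j) x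

  -- Walks from 0 to `j x` in steps of `x`: by `exp-+-≥` each step multiplies the series by at least
  -- `1 + x`, at the cost of one more term.
  [1+x]^j≤exp : ∀ j {x} → 0# ≤ x → (1# + x) ^ j ≤ exp (suc j) (fromℕ j * x)
  [1+x]^j≤exp zero {x} 0≤x = inj₂ (sym (trans (+-identityʳ _) (trans (*-identityˡ _) 1/0!≈1)))
  [1+x]^j≤exp (suc j) {x} 0≤x = begin
    (1# + x) * (1# + x) ^ j
      ≤⟨ *-monoʳ-≤ (+-nonneg 0≤1 0≤x) ([1+x]^j≤exp j 0≤x) ⟩
    (1# + x) * exp (suc j) y
      ≈⟨ solve 2 (λ x a → (con 1 :+ x) :* a := a :+ x :* a) refl x (exp (suc j) y) ⟩
    exp (suc j) y + x * exp (suc j) y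
      ≤⟨ +-monoˡ-≤ _ (exp-mono (suc j) 0≤y) ⟩
    exp (suc (suc j)) y + x * exp (suc j) y
      ≤⟨ exp-+-≥ (suc j) 0≤x 0≤y ⟩
    exp (suc (suc j)) (y + x)
      ≈⟨ exp-cong (suc (suc j)) (fromℕ-suc-* j x) ⟨
    exp (suc (suc j)) (fromℕ (suc j) * x) ∎
    where
    y = fromℕ j * x
    0≤y : 0# ≤ y
    0≤y = *-nonneg (fromℕ-nonneg j) 0≤x

  -- With `w` standing for `1 - x`, `exp-+-≤` gives `w * exp N (y + x) ≤ exp N y`, so each of the
  -- `j` steps back to 0 uses up one factor `w`.
  w^j*exp≤1 : ∀ N j {w x} → 0# ≤ w → 0# ≤ x → w + x ≈ 1# → w ^ j * exp N (fromℕ j * x) ≤ 1#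
  w^j*exp≤1 N zero {w} {x} 0≤w 0≤x w+x≈1 =
    ≤-respˡ-≈ (sym (*-identityˡ _)) (exp-at-0 N (zeroˡ x))
  w^j*exp≤1 N (suc j) {w} {x} 0≤w 0≤x w+x≈1 = begin
    w * w ^ j * exp N (fromℕ (suc j) * x)
      ≈⟨ *-congˡ (exp-cong N (fromℕ-suc-* j x)) ⟩
    w * w ^ j * exp N (y + x)
      ≈⟨ solve 3 (λ a b c → a :* b :* c := b :* (a :* c)) refl _ _ _ ⟩
    w ^ j * (w * exp N (y + x))
      ≤⟨ *-monoʳ-≤ (^-nonneg j 0≤w) (+-cancelʳ-≤ (x * exp N (y + x)) (begin
        w * exp N (y + x) + x * exp N (y + x)  ≈⟨ distribʳ _ w x ⟨
        (w + x) * exp N (y + x)                ≈⟨ *-congʳ w+x≈1 ⟩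
        1# * exp N (y + x)                     ≈⟨ *-identityˡ _ ⟩
        exp N (y + x)                          ≤⟨ exp-+-≤ N 0≤x (*-nonneg (fromℕ-nonneg j) 0≤x) ⟩
        exp N y + x * exp N (y + x)            ∎)) ⟩
    w ^ j * exp N y
      ≤⟨ w^j*exp≤1 N j 0≤w 0≤x w+x≈1 ⟩
    1# ∎
    where y = fromℕ j * x

  exp-at-1 : ∀ N {y} → y ≈ 1# → exp N y ≈ e-partialSum N
  exp-at-1 N y≈1 = sum-cong-≋ {N} λ k →
    trans (*-congʳ (trans (^-congˡ (toℕ k) y≈1) (1^k≈1 (toℕ k)))) (*-identityˡ _)

  e-isSupremum : IsSupremum (λ x → ∃ λ n → x ≈ e-partialSum n) e
  e-isSupremum = proj₂ (supremum _ _ _)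

  e-partialSum≤e : ∀ n → e-partialSum n ≤ e
  e-partialSum≤e n = proj₁ e-isSupremum _ (n , refl)

  e-least : ∀ {b} → (∀ n → e-partialSum n ≤ b) → e ≤ b
  e-least {b} sums≤b = ≮⇒≥ λ b<e → let x , (n , x≈sum) , b<x = proj₂ e-isSupremum b b<e in
    <⇒≱ b<x (≤-respˡ-≈ (sym x≈sum) (sums≤b n))

  1≤e : 1# ≤ e
  1≤e = ≤-respˡ-≈ (trans (+-identityʳ _) 1/0!≈1) (e-partialSum≤e 1)

  0<e : 0# < e
  0<e = <-≤-trans 0<1 1≤e

  -- This is `(1 + 1 / p) ^ p ≤ e` without division: `[1+x]^j≤exp` with `x = 1 / p` and `j = p`.
  [1+p]^p≤p^p*e : ∀ p → fromℕ (suc p) ^ p ≤ fromℕ p ^ p * e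
  [1+p]^p≤p^p*e zero = ≤-respʳ-≈ (sym (*-identityˡ e)) 1≤e
  [1+p]^p≤p^p*e p@(suc p-1) = begin
    (1# + P) ^ p
      ≈⟨ ^-congˡ p (begin-equality
        1# + P            ≈⟨ +-cong (sym Px≈1) (sym (*-identityʳ P)) ⟩
        P * x + P * 1#    ≈⟨ distribˡ P x 1# ⟨
        P * (x + 1#)      ≈⟨ *-congˡ (+-comm x 1#) ⟩
        P * (1# + x)      ∎) ⟩
    (P * (1# + x)) ^ p
      ≈⟨ ^-distrib-* P (1# + x) p ⟩
    P ^ p * (1# + x) ^ p
      ≤⟨ *-monoʳ-≤ 0≤Pᵖ ([1+x]^j≤exp p (inj₁ (⁻¹-pos 0<P))) ⟩
    P ^ p * exp (suc p) (P * x)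
      ≈⟨ *-congˡ (exp-at-1 (suc p) Px≈1) ⟩
    P ^ p * e-partialSum (suc p)
      ≤⟨ *-monoʳ-≤ 0≤Pᵖ (e-partialSum≤e (suc p)) ⟩
    P ^ p * e ∎
    where
    P = fromℕ p
    x = P ⁻¹
    0<P : 0# < P
    0<P = fromℕ-suc-pos p-1
    0≤Pᵖ : 0# ≤ P ^ p
    0≤Pᵖ = inj₁ (fromℕ-^-self-pos p)
    Px≈1 : P * x ≈ 1#
    Px≈1 = *-inverseʳ P (<⇒≉0 0<P)

  ρ*-upper : ∀ p → ρ* (suc p) ≤ e * fromℕ (suc p)
  ρ*-upper p = *-cancelˡ-≤ (fromℕ-^-self-pos p) (begin
    P ^ p * ρ* (suc p)  ≈⟨ ρ*-cancel p ⟩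
    Q * Q ^ p           ≤⟨ *-monoʳ-≤ (fromℕ-nonneg (suc p)) ([1+p]^p≤p^p*e p) ⟩
    Q * (P ^ p * e)     ≈⟨ solve 3 (λ a b c → a :* (b :* c) := b :* (c :* a)) refl _ _ _ ⟩
    P ^ p * (e * Q)     ∎)
    where
    P = fromℕ p
    Q = fromℕ (suc p)

  -- `w^j*exp≤1` with `w = p / (p + 1)`, `x = 1 / (p + 1)` and `j = p + 1`, so that the series is
  -- evaluated at `j x = 1`.
  p*e-partialSum≤ρ* : ∀ p n → fromℕ p * e-partialSum n ≤ ρ* (suc p)
  p*e-partialSum≤ρ* p n = *-cancelˡ-≤ (fromℕ-^-self-pos p) (begin
    P ^ p * (P * E)
      ≈⟨ solve 3 (λ a b c → a :* (b :* c) := b :* a :* c) refl _ _ _ ⟩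
    P ^ suc p * E
      ≈⟨ *-congʳ (^-congˡ (suc p) (*⁻¹-cancel 0<Q P)) ⟨
    (Q * (P / Q)) ^ suc p * E
      ≈⟨ *-cong (^-distrib-* Q (P / Q) (suc p)) (sym (exp-at-1 n Qx≈1)) ⟩
    Q ^ suc p * (P / Q) ^ suc p * exp n (Q * x)
      ≈⟨ *-assoc _ _ _ ⟩
    Q ^ suc p * ((P / Q) ^ suc p * exp n (Q * x))
      ≤⟨ *-monoʳ-≤ (^-nonneg (suc p) (fromℕ-nonneg (suc p)))
           (w^j*exp≤1 n (suc p) (*-nonneg (fromℕ-nonneg p) 0≤x) 0≤x P/Q+x≈1) ⟩
    Q ^ suc p * 1#
      ≈⟨ *-identityʳ _ ⟩
    Q ^ suc p
      ≈⟨ ρ*-cancel p ⟨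
    P ^ p * ρ* (suc p) ∎)
    where
    P = fromℕ p
    Q = fromℕ (suc p)
    E = e-partialSum n
    x = Q ⁻¹
    0<Q : 0# < Q
    0<Q = fromℕ-suc-pos p
    0≤x : 0# ≤ x
    0≤x = inj₁ (⁻¹-pos 0<Q)
    Qx≈1 : Q * x ≈ 1#
    Qx≈1 = *-inverseʳ Q (<⇒≉0 0<Q)
    P/Q+x≈1 : P / Q + x ≈ 1#
    P/Q+x≈1 = trans (solve 2 (λ p x → p :* x :+ x := (con 1 :+ p) :* x) refl P x) Qx≈1

  ρ*-lower : ∀ p → e * fromℕ p ≤ ρ* (suc p)
  ρ*-lower zero = ≤-respˡ-≈ (sym (zeroʳ e)) (inj₁ (ρ*-pos 0))
  ρ*-lower p@(suc p-1) = begin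
    e * P                 ≤⟨ *-monoˡ-≤ (fromℕ-nonneg p) (e-least λ n → *-cancelˡ-≤ 0<P (begin
      P * e-partialSum n    ≤⟨ p*e-partialSum≤ρ* p n ⟩
      ρ* (suc p)            ≈⟨ *⁻¹-cancel 0<P _ ⟨
      P * (ρ* (suc p) / P)  ∎)) ⟩
    ρ* (suc p) / P * P    ≈⟨ *-comm _ _ ⟩
    P * (ρ* (suc p) / P)  ≈⟨ *⁻¹-cancel 0<P _ ⟩
    ρ* (suc p)            ∎
    where
    P = fromℕ p
    0<P : 0# < P
    0<P = fromℕ-suc-pos p-1

  -- The o(1) of the asymptotic form. For `m ≤ 1` it contains the inverse of zero, so both facts
  -- about it start at `m = 2`.
  relativeError : ℕ → Carrier
  relativeError m = ρ* (m ∸ 1) / (e * fromℕ (m ∸ 1)) - 1#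

  private
    0<e*n : ∀ p → 0# < e * fromℕ (suc p)
    0<e*n p = *-pos _ _ 0<e (fromℕ-suc-pos p)

  ρ*≈[1+relativeError]*e*n : ∀ m → 2 ℕ.≤ m →
    ρ* (m ∸ 1) ≈ (1# + relativeError m) * (e * fromℕ (m ∸ 1))
  ρ*≈[1+relativeError]*e*n (suc n@(suc p)) _ = sym (begin-equality
    (1# + relativeError (suc n)) * d  ≈⟨ *-comm _ d ⟩
    d * (1# + relativeError (suc n))  ≈⟨ *-congˡ (trans (+-comm 1# _) (x-y+y≈x _ 1#)) ⟩
    d * (ρ* n / d)                    ≈⟨ *⁻¹-cancel (0<e*n p) (ρ* n) ⟩
    ρ* n                              ∎)
    where d = e * fromℕ n
  ρ*≈[1+relativeError]*e*n (suc zero) (ℕ.s≤s ())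

  -- By `ρ*-lower` and `ρ*-upper` the error for `n = m - 1` lies between `- 1 / n` and 0, so it
  -- suffices that `n` exceeds `1 / ε`.
  relativeError-tendsToZero : TendsToZero relativeError
  relativeError-tendsToZero ε 0<ε with archimedean (ε ⁻¹)
  ... | N , ε⁻¹<N = 2 ℕ.+ N , λ where
      (suc (suc p)) (ℕ.s≤s (ℕ.s≤s N≤p)) →
        bounds p (<-≤-trans ε⁻¹<N (fromℕ-mono-≤ (ℕ.m≤n⇒m≤1+n N≤p)))
    where
    bounds : ∀ p → ε ⁻¹ < fromℕ (suc p) →
             - ε < relativeError (2 ℕ.+ p) × relativeError (2 ℕ.+ p) < ε
    bounds p ε⁻¹<n = lower , upper
      where
      n = suc p
      d = e * fromℕ n
      r = ρ* n / d

      r≤1 : r ≤ 1#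
      r≤1 = *-cancelˡ-≤ (0<e*n p) (begin
        d * r   ≈⟨ *⁻¹-cancel (0<e*n p) (ρ* n) ⟩
        ρ* n    ≤⟨ ρ*-upper p ⟩
        d       ≈⟨ *-identityʳ d ⟨
        d * 1#  ∎)

      1<n*ε : 1# < fromℕ n * ε
      1<n*ε = begin-strict
        1#           ≈⟨ *-inverseʳ ε (<⇒≉0 0<ε) ⟨
        ε * ε ⁻¹     <⟨ *-monoʳ-< 0<ε ε⁻¹<n ⟩
        ε * fromℕ n  ≈⟨ *-comm _ _ ⟩
        fromℕ n * ε  ∎

      -- After multiplication by `d`, which is `e * p + e`: the part `e * p` is at most `ρ* n`, and
      -- the part `e` is less than `d * ε`.
      1<r+ε : 1# < r + ε
      1<r+ε = *-cancelˡ-< (inj₁ (0<e*n p)) (begin-strict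
        d * 1#                         ≈⟨ solve 2 (λ e p → e :* (con 1 :+ p) :* con 1 := e :* p :+ e :* con 1)
                                              refl e (fromℕ p) ⟩
        e * fromℕ p + e * 1#           <⟨ +-monoʳ-< _ (*-monoʳ-< 0<e 1<n*ε) ⟩
        e * fromℕ p + e * (fromℕ n * ε)  ≤⟨ +-monoˡ-≤ _ (ρ*-lower p) ⟩
        ρ* n + e * (fromℕ n * ε)       ≈⟨ +-cong (*⁻¹-cancel (0<e*n p) (ρ* n)) (*-assoc _ _ _) ⟨
        d * r + d * ε                  ≈⟨ distribˡ d r ε ⟨
        d * (r + ε)                    ∎)

      lower : - ε < r - 1#
      lower = begin-strict
        - ε                      ≈⟨ +-identityˡ _ ⟨
        0# + - ε                 ≈⟨ +-congʳ (-‿inverseʳ 1#) ⟨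
        (1# - 1#) + - ε          <⟨ +-monoˡ-< _ _ (- ε) (+-monoˡ-< _ _ (- 1#) 1<r+ε) ⟩
        ((r + ε) - 1#) + - ε     ≈⟨ solve 4 (λ r ε a b → ((r :+ ε) :+ a) :+ b := (r :+ a) :+ (ε :+ b))
                                        refl r ε (- 1#) (- ε) ⟩
        (r - 1#) + (ε - ε)       ≈⟨ +-congˡ (-‿inverseʳ ε) ⟩
        (r - 1#) + 0#            ≈⟨ +-identityʳ _ ⟩
        r - 1#                   ∎

      upper : r - 1# < ε
      upper = begin-strict
        r - 1#   ≤⟨ +-monoˡ-≤ (- 1#) r≤1 ⟩
        1# - 1#  ≈⟨ -‿inverseʳ 1# ⟩
        0#       <⟨ 0<ε ⟩
        ε        ∎

-- Suprema in [0 , ∞], prefix sums and products.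

module StarSearch (ℝ : CompleteOrderedField) where

  open OrderedField ℝ
  open Max totalOrder using (_⊔_; x≤x⊔y; x≤y⊔x; x≤y⇒x⊔y≈y; x≤y⇒y⊔x≈y)
  open AddSupremum _≤_ using ([_]; _≤⊤⁺)

  -- Deciding the same proposition as the definition makes `⋁ f` reduce. The bound `b` found there
  -- excludes that `f i` is infinite, so its value lies in the set whose supremum was taken.
  ⋁-upper : {I : Set} (f : I → ℝ∞) {c : Carrier} → ⋁ f ≤∞ [ c ] → ∀ i → f i ≤∞ [ c ]
  ⋁-upper f ⋁f≤c i with excludedMiddle (∃ λ b → 0# ≤ b × (∀ i → f i ≤∞ [ b ])) | ⋁f≤c
  ... | no _              | ()
  ... | yes (b , _ , f≤b) | [ s≤c ] with f i in fi≡ | f≤b i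
  ...   | [ x ] | _ = [ ≤-trans (proj₁ (proj₂ (supremum _ _ _)) x (inj₂ (i , fi≡))) s≤c ]

  -- Reduces a lower bound on a supremum to an inequality for each finite upper bound; an infinite
  -- supremum leaves nothing to show.
  ≤∞-⋁ : {I : Set} (f : I → ℝ∞) {a : Carrier} →
         (∀ b → (∀ i → f i ≤∞ [ b ]) → a ≤ b) → [ a ] ≤∞ ⋁ f
  ≤∞-⋁ f a≤ with ⋁ f in ⋁f≡
  ... | ⊤⁺    = [ _ ] ≤⊤⁺
  ... | [ s ] = [ a≤ s (⋁-upper f (≡.subst (_≤∞ [ s ]) (≡.sym ⋁f≡) [ ≤-refl ])) ]

  prefixSum : (ℕ → Carrier) → ℕ → Carrier
  prefixSum f k = sum (λ (j : Fin k) → f (toℕ j))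

  prefixSum-suc : ∀ f k → prefixSum f (suc k) ≈ prefixSum f k + f k
  prefixSum-suc f zero    = +-comm _ _
  prefixSum-suc f (suc k) = trans (+-congˡ (prefixSum-suc (λ i → f (suc i)) k)) (sym (+-assoc _ _ _))

  prefixSum-nonneg : ∀ {f} → (∀ i → 0# ≤ f i) → ∀ k → 0# ≤ prefixSum f k
  prefixSum-nonneg 0≤f zero    = ≤-refl
  prefixSum-nonneg 0≤f (suc k) = +-nonneg (0≤f 0) (prefixSum-nonneg (λ i → 0≤f (suc i)) k)

  prefixSum-mono : ∀ {f} → (∀ i → 0# ≤ f i) → ∀ {j k} → j ℕ.≤ k → prefixSum f j ≤ prefixSum f k
  prefixSum-mono 0≤f {k = k} ℕ.z≤n   = prefixSum-nonneg 0≤f k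
  prefixSum-mono 0≤f (ℕ.s≤s j≤k)     = +-monoʳ-≤ _ (prefixSum-mono (λ i → 0≤f (suc i)) j≤k)

  -- Replacing factor `j` multiplies the product by `g j / f j`; cross-multiplied to avoid the
  -- division.
  product-update : ∀ {n} (f g : Fin n → Carrier) j → (∀ i → i ≢ j → g i ≈ f i) →
                   product g * f j ≈ product f * g j
  product-update {suc n} f g j g≈f = begin-equality
    product g * f j                     ≈⟨ *-congʳ (product-remove {i = j} g) ⟩
    g j * product (removeAt g j) * f j  ≈⟨ *-congʳ (*-congˡ (product-cong {n} λ i → g≈f _ (Fin.punchInᵢ≢i j i))) ⟩
    g j * product (removeAt f j) * f j  ≈⟨ solve 3 (λ a b c → a :* b :* c := c :* b :* a) refl _ _ _ ⟩
    f j * product (removeAt f j) * g j  ≈⟨ *-congʳ (product-remove {i = j} f) ⟨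
    product f * g j                     ∎

  ^-≤-product : ∀ {n} {f : Fin n → Carrier} {a} → 0# ≤ a → (∀ j → a ≤ f j) → a ^ n ≤ product f
  ^-≤-product {zero}  0≤a a≤f = ≤-refl
  ^-≤-product {suc n} 0≤a a≤f =
    *-mono-≤ (≤-trans 0≤a (a≤f zero)) (^-nonneg n 0≤a) (a≤f zero) (^-≤-product {n} 0≤a (λ j → a≤f (suc j)))

  -- Travel and frontiers of a single search strategy.

  module Strategy {m : ℕ} {d₀ : Carrier} (0<d₀ : 0# < d₀) (X : SearchStrategy m) where

    open SearchStrategy X

    travel : ℕ → Carrier
    travel = prefixSum length

    length-nonneg : ∀ i → 0# ≤ length i
    length-nonneg i = inj₁ (length-pos i)

    -- Accounts for the iterations before `k` only. The initial value `d₀` makes every distance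
    -- beyond a frontier admissible for a target.
    frontier : Fin m → ℕ → Carrier
    frontier r zero    = d₀
    frontier r (suc k) with ray k Fin.≟ r
    ... | yes _ = frontier r k ⊔ length k
    ... | no  _ = frontier r k

    frontier-visited : ∀ {r k} → ray k ≡ r → frontier r (suc k) ≡ frontier r k ⊔ length k
    frontier-visited {r} {k} ray≡r with ray k Fin.≟ r
    ... | yes _    = ≡.refl
    ... | no ray≢r = contradiction ray≡r ray≢r

    frontier-unvisited : ∀ {r k} → ray k ≢ r → frontier r (suc k) ≡ frontier r k
    frontier-unvisited {r} {k} ray≢r with ray k Fin.≟ r
    ... | yes ray≡r = contradiction ray≡r ray≢r
    ... | no _      = ≡.refl

    frontier-suc : ∀ r k → frontier r k ≤ frontier r (suc k)
    frontier-suc r k with ray k Fin.≟ r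
    ... | yes _ = x≤x⊔y (frontier r k) (length k)
    ... | no  _ = ≤-refl

    d₀≤frontier : ∀ r k → d₀ ≤ frontier r k
    d₀≤frontier r zero    = ≤-refl
    d₀≤frontier r (suc k) = ≤-trans (d₀≤frontier r k) (frontier-suc r k)

    frontier-pos : ∀ r k → 0# < frontier r k
    frontier-pos r k = <-≤-trans 0<d₀ (d₀≤frontier r k)

    length≤frontier : ∀ {r i k} → ray i ≡ r → i ℕ.< k → length i ≤ frontier r k
    length≤frontier {r} {i} {suc k} ray≡r (ℕ.s≤s i≤k) with ℕ.m≤n⇒m<n∨m≡n i≤k
    ... | inj₁ i<k    = ≤-trans (length≤frontier ray≡r i<k) (frontier-suc r k)
    ... | inj₂ ≡.refl = ≡.subst (length i ≤_) (≡.sym (frontier-visited ray≡r))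
                          (x≤y⊔x (frontier r i) (length i))

    -- A finite bound excludes an infinite ratio; clearing the denominator gives
    -- `2 travel i + d ≤ (1 + 2 β) d` for the iteration `i` that finds the target.
    ratio-bound : ∀ (t : Target m d₀) {b β} → b ≈ 1# + fromℕ 2 * β → ratio X t ≤∞ [ b ] →
                  ∃ λ i → Reaches X t i × travel i ≤ β * Target.distance t
    ratio-bound t {b} {β} b≈ ratio≤b with excludedMiddle (∃ (FirstReaches X t)) | ratio≤b
    ... | yes (i , reaches , _) | [ cost/d≤b ] = i , reaches ,
      *-cancelˡ-≤ (fromℕ-suc-pos 1) (+-cancelʳ-≤ d (begin
        fromℕ 2 * travel i + d              ≈⟨ *⁻¹-cancel 0<d _ ⟨
        d * ((fromℕ 2 * travel i + d) / d)  ≤⟨ *-monoʳ-≤ (inj₁ 0<d) cost/d≤b ⟩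
        d * b                               ≈⟨ *-congˡ b≈ ⟩
        d * (1# + fromℕ 2 * β)              ≈⟨ solve 3 (λ d x β → d :* (con 1 :+ x :* β) := x :* (β :* d) :+ d)
                                                   refl d (fromℕ 2) β ⟩
        fromℕ 2 * (β * d) + d               ∎))
      where
      d = Target.distance t
      0<d : 0# < d
      0<d = <-≤-trans 0<d₀ (Target.d₀≤distance t)

    -- One ray with its own bound, to serve with the consistency on ray 0 and with the robustness on
    -- the other rays.
    module Ray (r : Fin m) {b β : Carrier} (b≈ : b ≈ 1# + fromℕ 2 * β)
               (ratio≤b : (t : Target m d₀) → Target.ray t ≡ r → ratio X t ≤∞ [ b ]) where

      -- A target beyond the frontier cannot be found before iteration `k`, since earlier iterations
      -- on `r` end within the frontier.
      reach-beyond : ∀ k d → frontier r k < d →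
                     ∃ λ i → k ℕ.≤ i × ray i ≡ r × d ≤ length i × travel i ≤ β * d
      reach-beyond k d f<d
        with ratio-bound t b≈ (ratio≤b t ≡.refl)
        where
        t : Target m d₀
        t = record { ray = r ; distance = d ; d₀≤distance = ≤-trans (d₀≤frontier r k) (inj₁ f<d) }
      ... | i , (ray≡r , d≤length) , travel≤ =
        i , ℕ.≮⇒≥ (λ i<k → <⇒≱ (<-≤-trans f<d d≤length) (length≤frontier ray≡r i<k)) ,
        ray≡r , d≤length , travel≤

      eventually-extended : ∀ k → ∃ λ i → k ℕ.≤ i × ray i ≡ r × frontier r k < length i
      eventually-extended k with reach-beyond k (frontier r k + 1#) (x<x+y 0<1)
      ... | i , k≤i , ray≡r , f+1≤length , _ = i , k≤i , ray≡r , <-≤-trans (x<x+y 0<1) f+1≤length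

      travel≤β*d : ∀ k d → frontier r k < d → travel k ≤ β * d
      travel≤β*d k d f<d with reach-beyond k d f<d
      ... | i , k≤i , _ , _ , travel≤ = ≤-trans (prefixSum-mono length-nonneg k≤i) travel≤

      0<β : 0# < β
      0<β = *-cancelˡ-< (inj₁ 0<d) (begin-strict
        d * 0#    ≈⟨ zeroʳ d ⟩
        0#        <⟨ length-pos 0 ⟩
        length 0  ≈⟨ +-identityʳ _ ⟨
        travel 1  ≤⟨ travel≤β*d 1 d (x<x+y 0<1) ⟩
        β * d     ≈⟨ *-comm β d ⟩
        d * β     ∎)
        where
        d = frontier r 1 + 1#
        0<d : 0# < d
        0<d = <-trans (frontier-pos r 1) (x<x+y 0<1)

      -- The target approaches the frontier from outside. Instead of a limit: a violation leaves
      -- room for a target distance `x` between the frontier and `travel k / β`.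
      travel≤β*frontier : ∀ k → travel k ≤ β * frontier r k
      travel≤β*frontier k = ≮⇒≥ λ βf<travel →
        let x , f<x , x<travel/β = dense (*-cancelˡ-< (inj₁ 0<β)
              (<-respʳ-≈ (sym (*⁻¹-cancel 0<β (travel k))) βf<travel))
        in <⇒≱ (<-respʳ-≈ (*⁻¹-cancel 0<β (travel k)) (*-monoʳ-< 0<β x<travel/β))
               (travel≤β*d k x f<x)

  linear≤^ : ∀ n {x} → 0# ≤ x → fromℕ n * x ≤ (1# + x) ^ n
  linear≤^ zero    {x} 0≤x = ≤-respˡ-≈ (sym (zeroˡ x)) 0≤1
  linear≤^ (suc k) {x} 0≤x = begin
    n * x                        ≈⟨ *-congˡ (trans (*-congˡ (1^k≈1 k)) (*-identityʳ x)) ⟨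
    n * (x * 1# ^ k)             ≤⟨ x≤y+x (^-nonneg (suc k) 0≤1) ⟩
    1# ^ suc k + n * (x * 1# ^ k)  ≤⟨ bernoulli k 0≤x 0≤1 ⟩
    (1# + x) ^ suc k             ∎
    where n = fromℕ (suc k)

  ^-unbounded : ∀ {q a} b → 1# < q → 0# < a → ∃ λ n → b < a * q ^ n
  ^-unbounded {q} {a} b 1<q 0<a with archimedean (b / (a * (q - 1#)))
  ... | n , b/ax<n = n , (begin-strict
    b                        ≈⟨ *⁻¹-cancel 0<ax b ⟨
    a * x * (b / (a * x))    <⟨ *-monoʳ-< 0<ax b/ax<n ⟩
    a * x * fromℕ n          ≈⟨ solve 3 (λ a x n → a :* x :* n := a :* (n :* x)) refl a x (fromℕ n) ⟩
    a * (fromℕ n * x)        ≤⟨ *-monoʳ-≤ (inj₁ 0<a) (linear≤^ n (inj₁ 0<x)) ⟩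
    a * (1# + x) ^ n         ≈⟨ *-congˡ (^-congˡ n (trans (+-comm 1# x) (x-y+y≈x q 1#))) ⟩
    a * q ^ n                ∎)
    where
    x = q - 1#
    0<x : 0# < x
    0<x = x<y⇒0<y-x 1<q
    0<ax : 0# < a * x
    0<ax = *-pos _ _ 0<a 0<x

  -- Travel and frontiers on the rays other than ray 0.

  module OtherRays {p : ℕ} {d₀ : Carrier} (0<d₀ : 0# < d₀) (X : SearchStrategy (suc (suc p))) where

    open SearchStrategy X
    open Strategy 0<d₀ X

    otherStep : Fin (suc (suc p)) → Carrier → Carrier
    otherStep zero    x = 0#
    otherStep (suc _) x = x

    otherLength : ℕ → Carrier
    otherLength i = otherStep (ray i) (length i)

    otherTravel : ℕ → Carrier
    otherTravel = prefixSum otherLength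

    otherLength-nonneg : ∀ i → 0# ≤ otherLength i
    otherLength-nonneg i with ray i
    ... | zero  = ≤-refl
    ... | suc _ = length-nonneg i

    otherTravel≤travel : ∀ k → otherTravel k ≤ travel k
    otherTravel≤travel k = sum-mono-≤ {k} λ j → step (toℕ j)
      where
      step : ∀ i → otherLength i ≤ length i
      step i with ray i
      ... | zero  = length-nonneg i
      ... | suc _ = ≤-refl

    otherTravel-zero : ∀ {k} → ray k ≡ zero → otherTravel (suc k) ≈ otherTravel k
    otherTravel-zero {k} ray≡0 = trans (prefixSum-suc otherLength k)
      (trans (+-congˡ (step (ray k) ray≡0)) (+-identityʳ _))
      where
      step : ∀ r → r ≡ zero → otherStep r (length k) ≈ 0#
      step zero _ = refl

    otherTravel-suc : ∀ {k} → ray k ≢ zero → otherTravel (suc k) ≈ otherTravel k + length k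
    otherTravel-suc {k} ray≢0 = trans (prefixSum-suc otherLength k) (+-congˡ (step (ray k) ray≢0))
      where
      step : ∀ r → r ≢ zero → otherStep r (length k) ≈ length k
      step zero    r≢0 = contradiction ≡.refl r≢0
      step (suc _) _   = refl

    -- Once above `d₀`, the frontier of ray 0 is the length of an iteration on ray 0, which counts
    -- in `travel` but not in `otherTravel`.
    otherTravel+frontier≤travel : ∀ k → frontier zero k ≤ d₀ ⊎ otherTravel k + frontier zero k ≤ travel k
    otherTravel+frontier≤travel zero = inj₁ ≤-refl
    otherTravel+frontier≤travel (suc k) with ray k Fin.≟ zero | otherTravel+frontier≤travel k
    ... | no ray≢0 | inj₁ f≤d₀  = inj₁ f≤d₀
    ... | no ray≢0 | inj₂ O+f≤S = inj₂ (begin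
      otherTravel (suc k) + f       ≈⟨ +-congʳ (otherTravel-suc ray≢0) ⟩
      otherTravel k + length k + f  ≈⟨ solve 3 (λ a b c → a :+ b :+ c := a :+ c :+ b) refl _ _ _ ⟩
      otherTravel k + f + length k  ≤⟨ +-monoˡ-≤ _ O+f≤S ⟩
      travel k + length k           ≈⟨ prefixSum-suc length k ⟨
      travel (suc k)                ∎)
      where f = frontier zero k
    ... | yes ray≡0 | ih with frontier zero k <? length k
    -- The new frontier is the length of this very iteration; earlier iterations on ray 0 are
    -- dropped by `otherTravel≤travel`.
    ...   | yes f<x = inj₂ (begin
      otherTravel (suc k) + (frontier zero k ⊔ length k)
        ≈⟨ +-cong (otherTravel-zero ray≡0) (x≤y⇒x⊔y≈y (inj₁ f<x)) ⟩
      otherTravel k + length k  ≤⟨ +-monoˡ-≤ _ (otherTravel≤travel k) ⟩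
      travel k + length k       ≈⟨ prefixSum-suc length k ⟨
      travel (suc k)            ∎)
    ...   | no f≮x = Sum.map
      (λ f≤d₀ → ≤-respˡ-≈ (sym f⊔x≈f) f≤d₀)
      (λ O+f≤S → begin
        otherTravel (suc k) + (frontier zero k ⊔ length k)
          ≈⟨ +-cong (otherTravel-zero ray≡0) f⊔x≈f ⟩
        otherTravel k + frontier zero k  ≤⟨ O+f≤S ⟩
        travel k                         ≤⟨ prefixSum-mono length-nonneg (ℕ.n≤1+n k) ⟩
        travel (suc k)                   ∎)
      ih
      where
      f⊔x≈f : frontier zero k ⊔ length k ≈ frontier zero k
      f⊔x≈f = x≤y⇒y⊔x≈y (≮⇒≥ f≮x)

    -- `stay` covers iterations on ray 0 as well as those that turn back within the frontier of
    -- another ray; the latter still increase `otherTravel`.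
    data Step (k : ℕ) : Set where
      stay   : (∀ j → frontier (suc j) (suc k) ≈ frontier (suc j) k) → Step k
      extend : ∀ i → ray k ≡ suc i → frontier (suc i) k < length k →
               frontier (suc i) (suc k) ≈ length k →
               (∀ j → j ≢ i → frontier (suc j) (suc k) ≈ frontier (suc j) k) → Step k

    step : ∀ k → Step k
    step k with ray k in ray≡
    ... | zero = stay λ j →
      reflexive (frontier-unvisited λ ray≡j → Fin.0≢1+n (≡.trans (≡.sym ray≡) ray≡j))
    ... | suc i with frontier (suc i) k <? length k
    ...   | yes f<x = extend i ray≡ f<x
      (trans (reflexive (frontier-visited ray≡)) (x≤y⇒x⊔y≈y (inj₁ f<x)))
      (λ j j≢i → reflexive (frontier-unvisited λ ray≡j →
        j≢i (Fin.suc-injective (≡.trans (≡.sym ray≡j) ray≡))))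
    ...   | no f≮x = stay unchanged
      where
      unchanged : ∀ j → frontier (suc j) (suc k) ≈ frontier (suc j) k
      unchanged j with ray k Fin.≟ suc j
      ... | no _ = refl
      ... | yes ray≡j with ≡.refl ← Fin.suc-injective (≡.trans (≡.sym ray≡j) ray≡) =
        x≤y⇒y⊔x≈y (≮⇒≥ f≮x)

    frontierProduct : ℕ → Carrier
    frontierProduct k = product λ j → frontier (suc j) k

    -- Extending frontier f to x multiplies the product by x / f, where μ O ≤ f;
    -- by AM-GM ρ* x Oᵖ is at most the new (O + x)ᵖ⁺¹.  So a bound a on the
    -- later values of product / Oᵖ⁺¹ gives the bound a ρ* μ on the present one.
    module Growth {K : ℕ} {μ : Carrier} (0<μ : 0# < μ)
      (μO≤frontier : ∀ k → K ℕ.≤ k → ∀ j → μ * otherTravel k ≤ frontier (suc j) k)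
      (extended : ∀ k → ∃ λ i → k ℕ.≤ i × ∃ λ j → ray i ≡ suc j × frontier (suc j) k < length i)
      where

      n : ℕ
      n = suc p

      q : Carrier
      q = ρ* n * μ

      0<q : 0# < q
      0<q = *-pos _ _ (ρ*-pos p) 0<μ

      0≤O : ∀ k → 0# ≤ otherTravel k
      0≤O = prefixSum-nonneg otherLength-nonneg

      -- A lower bound on the quotient of the frontier product by `otherTravel ^ n`,
      -- cross-multiplied because `otherTravel` may be zero.
      Bound : Carrier → Set
      Bound a = ∀ k → K ℕ.≤ k → a * otherTravel k ^ n ≤ frontierProduct k

      bound-μ^n : Bound (μ ^ n)
      bound-μ^n k K≤k = begin
        μ ^ n * otherTravel k ^ n  ≈⟨ ^-distrib-* μ (otherTravel k) n ⟨
        (μ * otherTravel k) ^ n    ≤⟨ ^-≤-product {n} (*-nonneg (inj₁ 0<μ) (0≤O k)) (μO≤frontier k K≤k) ⟩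
        frontierProduct k          ∎

      extend-bound : ∀ {a} → 0# ≤ a → Bound a → ∀ k → K ℕ.≤ k → ∀ i → ray k ≡ suc i →
        frontier (suc i) (suc k) ≈ length k →
        (∀ j → j ≢ i → frontier (suc j) (suc k) ≈ frontier (suc j) k) →
        a * q * otherTravel k ^ n ≤ frontierProduct k
      extend-bound {a} 0≤a bound k K≤k i ray≡ f′≈x others = *-cancelˡ-≤ (length-pos k) (begin
        x * (a * (ρ* n * μ) * (O * O ^ p))
          ≈⟨ solve 6 (λ x a r m o s → x :* (a :* (r :* m) :* (o :* s)) := a :* (r :* (x :* s)) :* (m :* o))
               refl x a (ρ* n) μ O (O ^ p) ⟩
        a * (ρ* n * (x * O ^ p)) * (μ * O)
          -- AM-GM in the left factor, the assumed lower bound on frontiers in the right one.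
          ≤⟨ *-mono-≤ (*-nonneg 0≤a (^-nonneg n (+-nonneg (0≤O k) 0≤x)))
               (*-nonneg (inj₁ 0<μ) (0≤O k))
               (*-monoʳ-≤ 0≤a (ρ*-≤ p 0≤x (0≤O k)))
               (μO≤frontier k K≤k i) ⟩
        a * (O + x) ^ n * f
          ≈⟨ *-congʳ (*-congˡ (^-congˡ n (otherTravel-suc ray≢0))) ⟨
        a * otherTravel (suc k) ^ n * f
          ≤⟨ *-monoˡ-≤ (inj₁ (frontier-pos (suc i) k)) (bound (suc k) (ℕ.m≤n⇒m≤1+n K≤k)) ⟩
        frontierProduct (suc k) * f
          ≈⟨ product-update {n} (λ j → frontier (suc j) k) (λ j → frontier (suc j) (suc k)) i others ⟩
        frontierProduct k * frontier (suc i) (suc k)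
          ≈⟨ *-congˡ f′≈x ⟩
        frontierProduct k * x
          ≈⟨ *-comm _ _ ⟩
        x * frontierProduct k ∎)
        where
        x = length k
        O = otherTravel k
        f = frontier (suc i) k
        0≤x : 0# ≤ x
        0≤x = length-nonneg k
        ray≢0 : ray k ≢ zero
        ray≢0 ray≡0 = Fin.0≢1+n (≡.trans (≡.sym ray≡0) ray≡)

      -- Goes forward to the next iteration extending another frontier, which occurs at `i` at the
      -- latest. Until then the product is constant and `otherTravel` does not decrease, so the
      -- bound obtained there holds at `k` as well.
      bound-* : ∀ {a} → 0# ≤ a → Bound a → Bound (a * q)
      bound-* {a} 0≤a bound k K≤k with extended k
      ... | i , k≤i , j , ray≡j , f<length with t , i≡ ← ℕ.m≤n⇒∃[o]m+o≡n k≤i =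
        descend t k K≤k (≡.trans (ℕ.+-comm t k) i≡) f<length
        where
        descend : ∀ t k → K ℕ.≤ k → t ℕ.+ k ≡ i → frontier (suc j) k < length i →
                  a * q * otherTravel k ^ n ≤ frontierProduct k
        descend t k K≤k t+k≡i f<length with step k
        ... | extend i ray≡ f<x f′≈x others = extend-bound 0≤a bound k K≤k i ray≡ f′≈x others
        -- At `k = i` staying is impossible: iteration `i` passes the frontier of ray `suc j`.
        descend zero k K≤k ≡.refl f<length | stay f′≈f =
          contradiction (≤-respʳ-≈ (f′≈f j) (length≤frontier ray≡j (ℕ.n<1+n k))) (<⇒≱ f<length)
        descend (suc t) k K≤k t+k≡i f<length | stay f′≈f = begin
          a * q * otherTravel k ^ n
            ≤⟨ *-monoʳ-≤ (*-nonneg 0≤a (inj₁ 0<q))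
                 (^-mono-≤ n (0≤O k) (prefixSum-mono otherLength-nonneg (ℕ.n≤1+n k))) ⟩
          a * q * otherTravel (suc k) ^ n
            ≤⟨ descend t (suc k) (ℕ.m≤n⇒m≤1+n K≤k) (≡.trans (ℕ.+-suc t k) t+k≡i)
                 (<-respˡ-≈ (sym (f′≈f j)) f<length) ⟩
          frontierProduct (suc k)
            ≈⟨ product-cong {n} f′≈f ⟩
          frontierProduct k ∎

      bound-^ : ∀ N → Bound (μ ^ n * q ^ N)
      bound-^ zero    k K≤k = ≤-respˡ-≈ (*-congʳ (sym (*-identityʳ _))) (bound-μ^n k K≤k)
      bound-^ (suc N) k K≤k = ≤-respˡ-≈
        (*-congʳ (solve 3 (λ a b c → a :* b :* c := a :* (c :* b)) refl (μ ^ n) (q ^ N) q))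
        (bound-* (*-nonneg (^-nonneg n (inj₁ 0<μ)) (^-nonneg N (inj₁ 0<q))) (bound-^ N) k K≤k)

      otherTravel-pos : ∃ λ k → K ℕ.≤ k × 0# < otherTravel k
      otherTravel-pos with extended K
      ... | i , K≤i , j , ray≡j , _ = suc i , ℕ.m≤n⇒m≤1+n K≤i , (begin-strict
        0#                        <⟨ length-pos i ⟩
        length i                  ≤⟨ x≤y+x (0≤O i) ⟩
        otherTravel i + length i  ≈⟨ otherTravel-suc (λ ray≡0 → Fin.0≢1+n (≡.trans (≡.sym ray≡0) ray≡j)) ⟨
        otherTravel (suc i)       ∎)

      -- If `q` exceeded 1, `bound-^` at one fixed `k` with positive `otherTravel k` would bound the
      -- single number `frontierProduct k` below by arbitrarily large numbers.
      q≤1 : q ≤ 1#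
      q≤1 = ≮⇒≥ λ 1<q →
        let k , K≤k , 0<O = otherTravel-pos
            a             = μ ^ n * otherTravel k ^ n
            N , P<aq^N    = ^-unbounded {a = a} (frontierProduct k) 1<q
                              (*-pos _ _ (^-pos n 0<μ) (^-pos n 0<O))
        in <⇒≱ P<aq^N (≤-respˡ-≈
             (solve 3 (λ a b c → a :* b :* c := a :* c :* b) refl (μ ^ n) (q ^ N) (otherTravel k ^ n))
             (bound-^ N k K≤k))

  -- Trade-off between consistency and robustness.

  ρ*-lower-bound : ∀ {p d₀} → 0# < d₀ → (X : DirectionalStrategy (suc (suc p))) →
    ∀ {c c̃ b β} → c ≈ 1# + fromℕ 2 * c̃ → 1# < c̃ → IsConsistent d₀ X c →
    b ≈ 1# + fromℕ 2 * β → (∀ h (t : Target _ d₀) → ratio (X h) t ≤∞ [ b ]) →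
    ρ* (suc p) * (1# + 1# / (c̃ - 1#)) ≤ β
  ρ*-lower-bound {p} {d₀} 0<d₀ X {c} {c̃} {b} {β} c≈ 1<c̃ consistent b≈ ratio≤b = begin
    ρ* n * κ        ≈⟨ *⁻¹-cancel 0<β _ ⟨
    β * (ρ* n * κ / β)  ≈⟨ *-congˡ (*-assoc _ _ _) ⟩
    β * (ρ* n * μ)  ≤⟨ *-monoʳ-≤ (inj₁ 0<β) (Growth.q≤1 0<μ μO≤frontier extended) ⟩
    β * 1#          ≈⟨ *-identityʳ β ⟩
    β               ∎
    where
    n = suc p
    open Strategy 0<d₀ (X zero)
    open OtherRays 0<d₀ (X zero)

    -- Under prediction 0, targets on ray 0 are governed by the consistency, all others by the
    -- robustness.
    module Predicted = Ray zero c≈ (λ t ray≡ → ⋁-upper _ consistent (zero , t , ray≡))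
    module Other j   = Ray (suc j) b≈ (λ t _ → ratio≤b zero t)

    0<β : 0# < β
    0<β = Other.0<β zero

    g w κ μ : Carrier
    g = c̃ - 1#
    w = 1# / g
    κ = 1# + w
    μ = κ / β

    0<g : 0# < g
    0<g = x<y⇒0<y-x 1<c̃

    0<w : 0# < w
    0<w = /-pos 0<1 0<g

    0<μ : 0# < μ
    0<μ = /-pos (<-trans 0<1 (x<x+y 0<w)) 0<β

    -- From `K` on, ray 0 has been searched beyond `d₀`, the value of `frontier zero 0`; this
    -- excludes the first alternative of `otherTravel+frontier≤travel`.
    K : ℕ
    K = suc (proj₁ (Predicted.eventually-extended 0))

    d₀<frontier : ∀ k → K ℕ.≤ k → d₀ < frontier zero k
    d₀<frontier k K≤k =
      let i , _ , ray≡0 , d₀<length = Predicted.eventually-extended 0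
      in <-≤-trans d₀<length (length≤frontier ray≡0 K≤k)

    O+f≤travel : ∀ k → K ℕ.≤ k → otherTravel k + frontier zero k ≤ travel k
    O+f≤travel k K≤k with otherTravel+frontier≤travel k
    ... | inj₁ f≤d₀  = contradiction f≤d₀ (<⇒≱ (d₀<frontier k K≤k))
    ... | inj₂ O+f≤S = O+f≤S

    wO≤frontier : ∀ k → K ℕ.≤ k → w * otherTravel k ≤ frontier zero k
    wO≤frontier k K≤k = *-cancelˡ-≤ 0<g (+-cancelʳ-≤ f (begin
      g * (w * O) + f  ≈⟨ +-congʳ (*-assoc g w O) ⟨
      g * w * O + f    ≈⟨ +-congʳ (*-congʳ (*⁻¹-cancel 0<g 1#)) ⟩
      1# * O + f       ≈⟨ +-congʳ (*-identityˡ O) ⟩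
      O + f            ≤⟨ O+f≤travel k K≤k ⟩
      travel k         ≤⟨ Predicted.travel≤β*frontier k ⟩
      c̃ * f            ≈⟨ *-congʳ (x-y+y≈x c̃ 1#) ⟨
      (g + 1#) * f     ≈⟨ solve 2 (λ g f → (g :+ con 1) :* f := g :* f :+ f) refl g f ⟩
      g * f + f        ∎))
      where
      O = otherTravel k
      f = frontier zero k

    μO≤frontier : ∀ k → K ℕ.≤ k → ∀ j → μ * otherTravel k ≤ frontier (suc j) k
    μO≤frontier k K≤k j = *-cancelˡ-≤ 0<β (begin
      β * (μ * O)            ≈⟨ *-assoc β μ O ⟨
      β * μ * O              ≈⟨ *-congʳ (*⁻¹-cancel 0<β κ) ⟩
      κ * O                  ≈⟨ solve 2 (λ w O → (con 1 :+ w) :* O := O :+ w :* O) refl w O ⟩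
      O + w * O              ≤⟨ +-monoʳ-≤ O (wO≤frontier k K≤k) ⟩
      O + frontier zero k    ≤⟨ O+f≤travel k K≤k ⟩
      travel k               ≤⟨ Other.travel≤β*frontier j k ⟩
      β * frontier (suc j) k ∎)
      where O = otherTravel k

    extended : ∀ k → ∃ λ i → k ℕ.≤ i × ∃ λ j →
               SearchStrategy.ray (X zero) i ≡ suc j × frontier (suc j) k < SearchStrategy.length (X zero) i
    extended k with Other.eventually-extended zero k
    -- It is enough that one other ray is extended over and over; `suc zero` exists as there are at
    -- least two rays.
    ... | i , k≤i , ray≡ , f<length = i , k≤i , zero , ray≡ , f<length

  -- `ρ` is kept up to `≈` so that the form with `ρ*` and the form with `e` are both instances.
  robustness-bound : ∀ m → 2 ℕ.≤ m → ∀ d₀ → 0# < d₀ → ∀ (X : DirectionalStrategy m) c c̃ →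
    c ≈ 1# + fromℕ 2 * c̃ → 1# < c̃ → IsConsistent d₀ X c →
    ∀ {ρ} → ρ ≈ ρ* (m ∸ 1) →
    [ 1# + fromℕ 2 * ρ * (1# + 1# / (c̃ - 1#)) ] ≤∞ robustness d₀ X
  robustness-bound (suc (suc p)) _ d₀ 0<d₀ X c c̃ c≈ 1<c̃ consistent {ρ} ρ≈ =
    ≤∞-⋁ _ λ b ratio≤b →
      -- Solves `b = 1 + 2 β` for an arbitrary finite upper bound `b` on the ratios.
      let β  = (b - 1#) / fromℕ 2
          b≈ : b ≈ 1# + fromℕ 2 * β
          b≈ = sym (trans (+-congˡ (*⁻¹-cancel (fromℕ-suc-pos 1) (b - 1#)))
                 (trans (+-comm 1# _) (x-y+y≈x b 1#)))
      in begin
        1# + fromℕ 2 * ρ * κ               ≈⟨ +-congˡ (*-assoc _ _ _) ⟩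
        1# + fromℕ 2 * (ρ * κ)             ≈⟨ +-congˡ (*-congˡ (*-congʳ ρ≈)) ⟩
        1# + fromℕ 2 * (ρ* (suc p) * κ)    ≤⟨ +-monoʳ-≤ 1# (*-monoʳ-≤ (fromℕ-nonneg 2)
          (ρ*-lower-bound 0<d₀ X c≈ 1<c̃ consistent b≈ λ h t → ratio≤b (h , t))) ⟩
        1# + fromℕ 2 * β                   ≈⟨ b≈ ⟨
        b                                  ∎
    where κ = 1# + 1# / (c̃ - 1#)
  robustness-bound (suc zero) (ℕ.s≤s ()) d₀ 0<d₀ X c c̃ c≈ 1<c̃ consistent ρ≈

theorem8 : (ℝ : CompleteOrderedField) →
    let open Search ℝ in
    (∀ (m : ℕ) → 2 ℕ.≤ m →
    ∀ (d₀ : Carrier) → 0# < d₀ →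
    ∀ (X : DirectionalStrategy m) (c c̃ : Carrier) →
    c ≈ 1# + fromℕ 2 * c̃ → 1# < c̃ → IsConsistent d₀ X c →
    [ 1# + fromℕ 2 * ρ* (m ∸ 1) * (1# + 1# / (c̃ - 1#)) ] ≤∞ robustness d₀ X)
    ×
    ∃ λ (δ : ℕ → Carrier) →
    TendsToZero δ
    ×
    (∀ (m : ℕ) → 2 ℕ.≤ m →
    ρ* (m ∸ 1) ≈ (1# + δ m) * (e * fromℕ (m ∸ 1)))
    ×
    (∀ (m : ℕ) → 2 ℕ.≤ m →
    ∀ (d₀ : Carrier) → 0# < d₀ →
    ∀ (X : DirectionalStrategy m) (c c̃ : Carrier) →
    c ≈ 1# + fromℕ 2 * c̃ → 1# < c̃ → IsConsistent d₀ X c →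
    [ 1# + fromℕ 2 * ((1# + δ m) * (e * fromℕ (m ∸ 1))) * (1# + 1# / (c̃ - 1#)) ]
    ≤∞ robustness d₀ X)
theorem8 ℝ =
  (λ m 2≤m d₀ 0<d₀ X c c̃ c≈ 1<c̃ consistent →
    robustness-bound m 2≤m d₀ 0<d₀ X c c̃ c≈ 1<c̃ consistent refl) ,
  relativeError , relativeError-tendsToZero , ρ*≈[1+relativeError]*e*n ,
  λ m 2≤m d₀ 0<d₀ X c c̃ c≈ 1<c̃ consistent →
    robustness-bound m 2≤m d₀ 0<d₀ X c c̃ c≈ 1<c̃ consistent
      (sym (ρ*≈[1+relativeError]*e*n m 2≤m))
  where
  open OrderedField ℝ using (refl; sym)
  open EulerNumber ℝ
  open StarSearch ℝ
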